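{- Let $(G,\sigma)$ be a connection graph and $i\neq j$ vertices, and write the conductance matrix as $\mathcal{C}^\sigma(i,j)=\begin{bmatrix}\mathcal{C}^\sigma_{ii}&\mathcal{C}^\sigma_{ij}\\ \mathcal{C}^\sigma_{ji}&\mathcal{C}^\sigma_{jj}\end{bmatrix}$. Then $$\mathcal{C}^\sigma_{ii}=\deg(i)\big(I_{d\times d}-(1-\mathbb{P}^i[T^1_j<T^1_i])\,\Omega^1_{ii}(j)\big),\qquad \mathcal{C}^\sigma_{ji}=-\deg(j)\,\mathbb{P}^j[T^1_i<T^1_j]\,\Omega^1_{ji}(j),$$ and, using $c_{ij}=\deg(i)\mathbb{P}^i[T^1_j<T^1_i]=\deg(j)\mathbb{P}^j[T^1_i<T^1_j]$, $$\mathcal{C}^\sigma(i,j)=c_{ij}\begin{bmatrix}I&-I\\-I&I\end{bmatrix}+\begin{bmatrix}(\deg(i)-c_{ij})(I-\Omega^1_{ii}(j))& c_{ij}(I-\Omega^1_{ij}(i))\\ c_{ij}(I-\Omega^1_{ji}(j))&(\deg(j)-c_{ij})(I-\Omega^1_{jj}(i))\end{bmatrix},$$ where $I=I_{d\times d}$.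
   Context: A connection graph $(G,\sigma)$: finite connected weighted graph $G=(V,E,W)$, $V=\{1,\dots,n\}$, $w_{xy}>0$ iff $\{x,y\}\in E$, $\deg(x)=\sum_y w_{xy}$, and $\sigma$ mapping oriented edges to $\mathsf{O}(d)$ with $\sigma_{yx}=\sigma_{xy}^{\mathrm T}$. Connection Laplacian $\mathcal{L}$: $nd\times nd$ block matrix with blocks $\deg(x)I_d$ on the diagonal, $-w_{xy}\sigma_{xy}$ for $x\sim y$, $0$ otherwise. For a block matrix $M=\begin{bmatrix}A&B\\C&D\end{bmatrix}$, $M/D=A-BD^\dagger C$ ($\dagger$ = Moore–Penrose inverse). The conductance matrix $\mathcal{C}^\sigma(i,j)\in\mathbb{R}^{2d\times2d}$ is the Schur complement $\mathcal{L}/\mathcal{L}_{\{i,j\}^c,\{i,j\}^c}$, with blocks ordered $i$ then $j$. Classical effective resistance $r_{ij}=(e_i-e_j)^{\mathrm T}L^\dagger(e_i-e_j)$ where $L=D-W$ is the graph Laplacian, and $c_{ij}=1/r_{ij}$. $(X_t)$: simple random walk with transition probabilities $w_{xy}/\deg(x)$; $\mathbb{P}^x$ given $X_0=x$; $T^1_k=\inf\{t\ge1:X_t=k\}$. For $a,b,k\in V$, $\Omega^1_{ab}(k)=\mathbb{E}^a\big[\prod_{\ell=1}^{T^1_b}\sigma_{X_{\ell-1}X_\ell}\mid T^1_b<T^1_k\big]$ (ordered product). -}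

module Defs where

open import Algebra.Bundles using (CommutativeRing)
open import Algebra.Structures using (IsCommutativeRing)
open import Data.Bool.Base using (if_then_else_)
open import Data.Fin.Base using (Fin; zero; suc; toℕ; combine; remQuot)
open import Data.Fin.Properties using (_≟_)
open import Data.List.Base as List using (List; []; _∷_; length; allFin; filter)
open import Data.Nat.Base as ℕ using (ℕ; zero; suc)
open import Data.Product.Base using (∃-syntax; _×_; _,_)
open import Data.Unit.Base using (⊤)
open import Data.Vec.Base as Vec using (Vec; []; _∷_)
open import Function.Base using (_∘_)
open import Function.Bundles using (_⇔_)
open import Level using (0ℓ)
open import Relation.Binary.Construct.Closure.ReflexiveTransitive using (Star)
open import Relation.Binary.PropositionalEquality using (_≡_; _≢_)
open import Relation.Binary.Structures using (IsDecTotalOrder)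
open import Relation.Nullary using (¬_; does)
open import Relation.Nullary.Decidable using (¬?; _×-dec_)
import Algebra.Properties.CommutativeMonoid.Sum as Summation

record OrderedField : Set₁ where
  infix  8 _⁻¹
  infix  8 -_
  infixl 7 _*_
  infixl 6 _+_ _-_
  infix  4 _≤_ _<_ _⟶_
  field
    ℝ                 : Set
    _+_ _*_           : ℝ → ℝ → ℝ
    -_ _⁻¹            : ℝ → ℝ
    0# 1#             : ℝ
    isCommutativeRing : IsCommutativeRing _≡_ _+_ _*_ -_ 0# 1#
    0≢1               : 0# ≢ 1#
    *-inverseʳ        : ∀ x → x ≢ 0# → x * x ⁻¹ ≡ 1#
    _≤_               : ℝ → ℝ → Set
    isDecTotalOrder   : IsDecTotalOrder _≡_ _≤_
    +-monoˡ-≤         : ∀ {x y} z → x ≤ y → x + z ≤ y + z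
    *-nonneg          : ∀ {x y} → 0# ≤ x → 0# ≤ y → 0# ≤ x * y

  open IsDecTotalOrder isDecTotalOrder public using (_≤?_)

  _<_ : ℝ → ℝ → Set
  x < y = x ≤ y × x ≢ y

  commutativeRing : CommutativeRing 0ℓ 0ℓ
  commutativeRing = record { isCommutativeRing = isCommutativeRing }

  open Summation (CommutativeRing.+-commutativeMonoid commutativeRing) public
    using (sum)

  _-_ : ℝ → ℝ → ℝ
  x - y = x + - y

  ∣_∣ : ℝ → ℝ
  ∣ x ∣ = if does (0# ≤? x) then x else - x

  fromℕ : ℕ → ℝ
  fromℕ zero    = 0#
  fromℕ (suc n) = 1# + fromℕ n

  _⟶_ : (ℕ → ℝ) → ℝ → Set
  s ⟶ l = ∀ ε → 0# < ε → ∃[ N ] (∀ n → N ℕ.≤ n → ∣ s n - l ∣ < ε)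

  Cauchy : (ℕ → ℝ) → Set
  Cauchy s = ∀ ε → 0# < ε →
    ∃[ N ] (∀ m n → N ℕ.≤ m → N ℕ.≤ n → ∣ s m - s n ∣ < ε)

-- The library has no real numbers, so they enter axiomatically, as an
-- Archimedean and Cauchy-complete totally ordered field.  These axioms
-- determine ℝ up to unique isomorphism; the order is decidable because the
-- mathematics is classical.
--
-- _⁻¹ and lim are total functions that are constrained only on nonzero
-- numbers and on Cauchy sequences respectively.
record RealNumbers : Set₁ where
  field
    orderedField : OrderedField

  open OrderedField orderedField public

  field
    archimedean : ∀ x → ∃[ n ] x ≤ fromℕ n
    lim         : (ℕ → ℝ) → ℝ
    complete    : ∀ s → Cauchy s → s ⟶ lim s

  partialSums : (ℕ → ℝ) → ℕ → ℝ
  partialSums f N = sum {N} (f ∘ toℕ)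

  ∑∞ : (ℕ → ℝ) → ℝ
  ∑∞ f = lim (partialSums f)

  HasSum : (ℕ → ℝ) → ℝ → Set
  HasSum f s = partialSums f ⟶ s

module Matrices (𝓡 : RealNumbers) where
  open RealNumbers 𝓡

  infix  8 _ᵀ
  infixr 7 _•_
  infixl 7 _·_
  infixl 6 _⊞_ _⊟_
  infix  4 _≋_

  Matrix : ℕ → ℕ → Set
  Matrix m n = Fin m → Fin n → ℝ

  _≋_ : ∀ {m n} → Matrix m n → Matrix m n → Set
  A ≋ B = ∀ r c → A r c ≡ B r c

  _⊞_ _⊟_ : ∀ {m n} → Matrix m n → Matrix m n → Matrix m n
  (A ⊞ B) r c = A r c + B r c
  (A ⊟ B) r c = A r c - B r c

  _•_ : ∀ {m n} → ℝ → Matrix m n → Matrix m n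
  (a • A) r c = a * A r c

  _·_ : ∀ {l m n} → Matrix l m → Matrix m n → Matrix l n
  (A · B) r c = sum λ k → A r k * B k c

  _ᵀ : ∀ {m n} → Matrix m n → Matrix n m
  (A ᵀ) r c = A c r

  I : ∀ {n} → Matrix n n
  I r c = if does (r ≟ c) then 1# else 0#

  Orthogonal : ∀ {n} → Matrix n n → Set
  Orthogonal Q = (Q ᵀ · Q ≋ I) × (Q · Q ᵀ ≋ I)

  -- The four Penrose conditions; every real matrix A has exactly one such A†.
  record IsMoorePenroseInverse {m n} (A : Matrix m n) (A† : Matrix n m) : Set where
    field
      AA†A≋A       : A · A† · A ≋ A
      A†AA†≋A†     : A† · A · A† ≋ A†
      AA†-symmetric : (A · A†) ᵀ ≋ A · A†
      A†A-symmetric : (A† · A) ᵀ ≋ A† · A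

  flatten : ∀ {m n} d → (Fin m → Fin n → Matrix d d) → Matrix (m ℕ.* d) (n ℕ.* d)
  flatten {m} {n} d B p q =
    let (x , r) = remQuot {m} d p
        (y , c) = remQuot {n} d q
    in B x y r c

  block : ∀ {m n} d → Matrix (m ℕ.* d) (n ℕ.* d) → Fin m → Fin n → Matrix d d
  block d M x y r c = M (combine x r) (combine y c)

  blocks₂ : ∀ d (A B C D : Matrix d d) → Matrix (2 ℕ.* d) (2 ℕ.* d)
  blocks₂ d A B C D = flatten {2} {2} d λ where
    zero    zero    → A
    zero    (suc _) → B
    (suc _) zero    → C
    (suc _) (suc _) → D

  -- The block submatrix M_{S,T}, its block rows and block columns listed in the
  -- order of S and T.
  submatrix : ∀ {n} d → Matrix (n ℕ.* d) (n ℕ.* d) → (S T : List (Fin n)) →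
              Matrix (length S ℕ.* d) (length T ℕ.* d)
  submatrix d M S T = flatten d λ s t → block d M (List.lookup S s) (List.lookup T t)

  -- M/D for M = [ A B ; C D ], given D†.
  schurComplement : ∀ {k l} → Matrix k k → Matrix k l → Matrix l k → Matrix l l → Matrix k k
  schurComplement A B C D† = A ⊟ B · D† · C

-- Edges are the pairs of positive weight; the graph is simple, hence has no
-- loops.  σ is a total function, but is constrained (and matters) only on edges.
record ConnectionGraph (𝓡 : RealNumbers) (n d : ℕ) : Set where
  open RealNumbers 𝓡
  open Matrices 𝓡

  infix 4 _∼_
  field
    w            : Fin n → Fin n → ℝ
    w-nonneg     : ∀ x y → 0# ≤ w x y
    w-symmetric  : ∀ x y → w x y ≡ w y x
    w-loopless   : ∀ x → w x x ≡ 0#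

  _∼_ : Fin n → Fin n → Set
  x ∼ y = 0# < w x y

  field
    connected    : ∀ x y → Star _∼_ x y
    σ            : Fin n → Fin n → Matrix d d
    σ-orthogonal : ∀ {x y} → x ∼ y → Orthogonal (σ x y)
    σ-transpose  : ∀ {x y} → x ∼ y → σ y x ≋ σ x y ᵀ

  deg : Fin n → ℝ
  deg x = sum (w x)

  L : Matrix n n
  L x y = deg x * I x y - w x y

  -- w x y ≡ 0# when x ≁ y, so those off-diagonal blocks vanish.
  𝓛 : Matrix (n ℕ.* d) (n ℕ.* d)
  𝓛 = flatten d λ x y → if does (x ≟ y) then deg x • I else (- w x y) • σ x y

  -- The set {i , j}ᶜ.
  others : Fin n → Fin n → List (Fin n)
  others i j = filter (λ x → ¬? (x ≟ i) ×-dec ¬? (x ≟ j)) (allFin n)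

  𝓛-others : ∀ i j → Matrix (length (others i j) ℕ.* d) (length (others i j) ℕ.* d)
  𝓛-others i j = submatrix d 𝓛 (others i j) (others i j)

  -- Here D† is to be the Moore–Penrose inverse of 𝓛-others i j.
  conductanceMatrix : ∀ i j (D† : Matrix (length (others i j) ℕ.* d) (length (others i j) ℕ.* d)) →
                      Matrix (2 ℕ.* d) (2 ℕ.* d)
  conductanceMatrix i j D† =
    schurComplement (submatrix d 𝓛 K K) (submatrix d 𝓛 K Kᶜ) (submatrix d 𝓛 Kᶜ K) D†
    where
    K Kᶜ : List (Fin n)
    K  = i ∷ j ∷ []
    Kᶜ = others i j

  -- Here L† is to be the Moore–Penrose inverse of L.
  effectiveResistance : (L† : Matrix n n) (i j : Fin n) → ℝ
  effectiveResistance L† i j = sum λ x → sum λ y → e x * (L† x y * e y)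
    where
    e : Fin n → ℝ
    e x = I i x - I j x

  effectiveConductance : (L† : Matrix n n) (i j : Fin n) → ℝ
  effectiveConductance L† i j = effectiveResistance L† i j ⁻¹

  transitionProbability : Fin n → Fin n → ℝ
  transitionProbability x y = w x y * deg x ⁻¹

  -- The ordered product σ_{x₀x₁} σ_{x₁x₂} ⋯ along x₀, x₁, ….
  transport : ∀ {t} → Vec (Fin n) (suc t) → Matrix d d
  transport (x ∷ [])     = I
  transport (x ∷ y ∷ xs) = σ x y · transport (y ∷ xs)

-- Predicates have no extensional equality, so both records below ask explicitly
-- for compatibility with pointwise equivalence.  Countable intersections follow
-- from complements and countable unions only classically.
record IsSigmaAlgebra {Ω : Set} (IsEvent : (Ω → Set) → Set₁) : Set₂ where
  field
    respects   : ∀ {A B} → (∀ ω → A ω ⇔ B ω) → IsEvent A → IsEvent B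
    universe   : IsEvent (λ _ → ⊤)
    complement : ∀ {A} → IsEvent A → IsEvent (λ ω → ¬ A ω)
    union      : ∀ {A : ℕ → Ω → Set} → (∀ n → IsEvent (A n)) → IsEvent (λ ω → ∃[ n ] A n ω)
    intersect  : ∀ {A : ℕ → Ω → Set} → (∀ n → IsEvent (A n)) → IsEvent (λ ω → ∀ n → A n ω)

-- ℙ is a total function on predicates, constrained only on events.
record IsProbabilityMeasure (𝓡 : RealNumbers) {Ω : Set} (IsEvent : (Ω → Set) → Set₁)
                            (ℙ : (Ω → Set) → RealNumbers.ℝ 𝓡) : Set₁ where
  open RealNumbers 𝓡
  field
    respects : ∀ {A B} → (∀ ω → A ω ⇔ B ω) → IsEvent A → ℙ A ≡ ℙ B
    nonneg   : ∀ {A} → IsEvent A → 0# ≤ ℙ A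
    total    : ℙ (λ _ → ⊤) ≡ 1#
    additive : ∀ {A : ℕ → Ω → Set} → (∀ n → IsEvent (A n)) →
               (∀ m n → m ≢ n → ∀ ω → ¬ (A m ω × A n ω)) →
               HasSum (λ n → ℙ (A n)) (ℙ (λ ω → ∃[ n ] A n ω))

-- The simple random walk (Xₜ) on an arbitrary measurable space, with the family
-- of measures ℙ a = ℙᵃ.
record SimpleRandomWalk {𝓡 : RealNumbers} {n d : ℕ} (G : ConnectionGraph 𝓡 n d) : Set₂ where
  open RealNumbers 𝓡
  open Matrices 𝓡
  open ConnectionGraph G

  field
    Ω              : Set
    IsEvent        : (Ω → Set) → Set₁
    isSigmaAlgebra : IsSigmaAlgebra IsEvent
    ℙ              : Fin n → (Ω → Set) → ℝ
    isProbability  : ∀ a → IsProbabilityMeasure 𝓡 IsEvent (ℙ a)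
    X              : ℕ → Ω → Fin n
    X-measurable   : ∀ t x → IsEvent (λ ω → X t ω ≡ x)

  -- X₀, …, Xₜ are the entries of xs.
  Follows : ∀ {t} → Vec (Fin n) (suc t) → Ω → Set
  Follows xs ω = ∀ s → X (toℕ s) ω ≡ Vec.lookup xs s

  field
    start  : ∀ a → ℙ a (λ ω → X 0 ω ≡ a) ≡ 1#
    markov : ∀ a {t} (xs : Vec (Fin n) (suc t)) y →
             ℙ a (λ ω → Follows xs ω × X (suc t) ω ≡ y)
               ≡ ℙ a (Follows xs) * transitionProbability (Vec.last xs) y

  -- T¹ₖ takes values in ℕ ∪ {∞}, so it is given by the events T¹ₖ > t and T¹ₖ = t.
  T¹[_]>_ T¹[_]≐_ : Fin n → ℕ → Ω → Set
  (T¹[ k ]> t) ω = ∀ s → 1 ℕ.≤ s → s ℕ.≤ t → X s ω ≢ k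
  (T¹[ k ]≐ t) ω = 1 ℕ.≤ t × X t ω ≡ k × (∀ s → 1 ℕ.≤ s → s ℕ.< t → X s ω ≢ k)

  T¹[_]<T¹[_] : Fin n → Fin n → Ω → Set
  T¹[ b ]<T¹[ k ] ω = ∃[ t ] ((T¹[ b ]≐ t) ω × (T¹[ k ]> t) ω)

  sumVec : ∀ t → (Vec (Fin n) t → ℝ) → ℝ
  sumVec zero    f = f []
  sumVec (suc t) f = sum λ x → sumVec t λ xs → f (x ∷ xs)

  -- 𝔼ᵃ[ transport(X₀,…,X_T) ; T < T¹ₖ ] with T = T¹_b.  The integrand is a function
  -- of the stopped trajectory (X₀,…,X_T), which takes countably many values xs on
  -- this event, so the expectation is the sum of value times probability.
  expectedTransport : (a b k : Fin n) → Matrix d d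
  expectedTransport a b k r c = ∑∞ λ t → sumVec (suc t) λ xs →
    ℙ a (λ ω → T¹[ b ]<T¹[ k ] ω × (T¹[ b ]≐ t) ω × Follows xs ω) * transport xs r c

  -- The expectation conditional on T¹_b < T¹ₖ.  If that event is null, then
  -- expectedTransport vanishes and so does Ω¹.
  Ω¹ : (a b k : Fin n) → Matrix d d
  Ω¹ a b k = ℙ a T¹[ b ]<T¹[ k ] ⁻¹ • expectedTransport a b k

{-# OPTIONS --safe #-}

-- Every entry of the conductance matrix is computed by first-step analysis.
--
-- Write S for the complement of {i , j} and Q for the transition matrix of the walk
-- killed on leaving S. The probability that the walk from x first hits {i , j} at b,
-- at time t + 1, satisfies h₀(x) = P(x,b) and hₜ₊₁ = Q hₜ; the transport along these
-- paths satisfies the same recursion twisted by σ.  Both decay: L† provides u ≥ 0 with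
-- Δ u = 1 off i, which yields g ≥ 0 with g − Q g ≥ 1/deg, and t · Qᵗ1 is bounded by a
-- multiple of g.  Since σ is orthogonal, Jensen's inequality makes the squared norm
-- of a transported vector field subharmonic, so the same decay applies to it.
--
-- Hence 𝓛_SS is injective, D† is its inverse, and the transports from S sum up to
-- −D† 𝓛_Sb.  One more step gives deg(a) (δ_ab I − 𝔼_ab) for the (a , b) block of the Schur
-- complement.  Stopping the harmonic functions 1 and L†(e_i − e_j) at {i , j} gives
-- ℙᵃ[T_i < T_j] + ℙᵃ[T_j < T_i] = 1 and deg(i) ℙⁱ[T_j < T_i] r_ij = 1.

module Submission where

open import Defs
open import Algebra.Bundles using (CommutativeRing)
open import Algebra.Solver.Ring.AlmostCommutativeRing using (AlmostCommutativeRing; fromCommutativeRing; _-Raw-AlmostCommutative⟶_)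
open import Data.Bool.Base using (if_then_else_; true; false)
open import Data.Empty using (⊥)
open import Data.Fin.Base using (Fin; zero; suc; toℕ; fromℕ<; _↑ˡ_; _↑ʳ_; combine; remQuot)
open import Data.Integer.Base as ℤ using (ℤ; -[1+_]; _⊖_)
open import Data.List.Base as List using (List; []; _∷_; length; allFin; filter; tabulate)
open import Data.List.Membership.Propositional.Properties using (∈-lookup)
open import Data.List.Relation.Unary.All as All using ()
open import Data.List.Relation.Unary.All.Properties using (all-filter)
open import Data.List.Relation.Unary.AllPairs using (_∷_)
open import Data.List.Relation.Unary.Unique.Propositional using (Unique)
open import Data.List.Relation.Unary.Unique.Propositional.Properties using (allFin⁺; filter⁺)
open import Data.Maybe.Base using (Maybe; just; nothing)
open import Data.Nat.Base as ℕ using (ℕ; zero; suc)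
open import Data.Product.Base using (∃-syntax; _×_; _,_; proj₁; proj₂)
open import Data.Sum.Base using (inj₁; inj₂; [_,_]′)
open import Data.Unit.Base using (⊤; tt)
open import Data.Vec.Base as Vec using (Vec; []; _∷_; _∷ʳ_)
open import Function.Base using (_∘_)
open import Function.Bundles using (_⇔_; mk⇔; Equivalence)
open import Level using (0ℓ)
open import Relation.Binary.Bundles using (Poset)
open import Relation.Binary.Construct.Closure.ReflexiveTransitive as Star using (Star; _◅_)
open import Relation.Binary.Definitions using (tri<; tri≈; tri>)
open import Relation.Binary.PropositionalEquality using (_≡_; _≢_; refl; sym; trans; cong; cong₂; subst; subst₂; module ≡-Reasoning)
open import Relation.Binary.Structures using (IsDecTotalOrder)
open import Relation.Nullary using (Dec; yes; no; does; ¬_; contradiction)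
open import Relation.Nullary.Decidable using (¬?; _×-dec_; dec-true; dec-false)
open import Relation.Unary using (Decidable; Pred)
import Algebra.Properties.AbelianGroup as AbelianGroupProperties
import Algebra.Properties.Ring as RingProperties
import Algebra.Properties.Semiring.Mult.TCOptimised as Multiples
import Algebra.Properties.Semiring.Sum as SemiringSum
import Algebra.Solver.Ring as RingSolver
import Data.Fin.Properties as Fin
import Data.Integer.Properties as ℤ
import Data.Nat.Properties as ℕ
import Data.Sign.Base as Sign
import Relation.Binary.Reasoning.PartialOrder as PartialOrderReasoning

-- Killing is decided on arrival: `q x y` carries the indicator of `y`, not of `x`. Starting points
-- `i` and `j` therefore obey the same recursion as interior ones, as first-return times demand, and
-- one decay estimate serves every vertex. Potentials are not obtained by solving linear systems.
-- They are columns of the given `L†`, and the maximum principle shows that what `L · L†` lacks from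
-- the identity cancels in differences. Convergence of the transport series is an outcome and not an
-- input. Transports have no sign, so monotonicity is of no use; but each partial sum satisfies an
-- exact linear equation on the interior whose error is the current term, and solving it exhibits
-- the limit. Only then can `lim`, which is unspecified on divergent sequences, be evaluated.
-- Conditioning enters through the product `ℙ * Ω¹`, which equals the unnormalised expectation even
-- on a null event. Such events do occur: the walk cannot return to `i` before `j` if `j` is the
-- only neighbour of `i`.

-- Equality on ℝ does not compute, so the solver can only cancel terms if coefficients are
-- taken in ℤ.
module IntegerCoefficientSolver (𝓕 : OrderedField) where
  open OrderedField 𝓕
  open CommutativeRing commutativeRing using (semiring; ring; +-abelianGroup; -‿inverseʳ; +-identityˡ; +-identityʳ; +-comm; +-assoc)
  open Multiples semiring using (×1-homo-*; ×-homo-+; 1+×) renaming (_×_ to _·_)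
  open RingProperties ring using (-‿distribˡ-*; -‿distribʳ-*; -0#≈0#; -‿involutive)
  open AbelianGroupProperties +-abelianGroup using () renaming (⁻¹-∙-comm to -‿+-comm)
  open ≡-Reasoning

  -- The multiples are the optimised ones, for which `0 · 1#` and `1 · 1#` reduce to `0#` and `1#`;
  -- the constants `con (ℤ.+ 0)` and `con (ℤ.+ 1)` in solver calls thus match by `refl`.
  embed : ℤ → ℝ
  embed (ℤ.+ n)    = n · 1#
  embed -[1+ n ] = - (suc n · 1#)

  embed-neg : ∀ z → embed (ℤ.- z) ≡ - embed z
  embed-neg (ℤ.+ zero)  = sym -0#≈0#
  embed-neg (ℤ.+ suc n) = refl
  embed-neg -[1+ n ]  = sym (-‿involutive _)

  cancel-1 : ∀ a b → (1# + a) - (1# + b) ≡ a - b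
  cancel-1 a b = begin
    (1# + a) + - (1# + b)     ≡⟨ cong ((1# + a) +_) (sym (-‿+-comm 1# b)) ⟩
    (1# + a) + (- 1# + - b)   ≡⟨ cong (_+ (- 1# + - b)) (+-comm 1# a) ⟩
    (a + 1#) + (- 1# + - b)   ≡⟨ +-assoc a 1# _ ⟩
    a + (1# + (- 1# + - b))   ≡⟨ cong (a +_) (sym (+-assoc 1# (- 1#) (- b))) ⟩
    a + ((1# + - 1#) + - b)   ≡⟨ cong (λ z → a + (z + - b)) (-‿inverseʳ 1#) ⟩
    a + (0# + - b)            ≡⟨ cong (a +_) (+-identityˡ (- b)) ⟩
    a + - b                   ∎

  embed-⊖ : ∀ m n → embed (m ⊖ n) ≡ m · 1# - n · 1#
  embed-⊖ zero    zero    = sym (-‿inverseʳ 0#)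
  embed-⊖ zero    (suc n) = sym (+-identityˡ _)
  embed-⊖ (suc m) zero    = sym (trans (cong (suc m · 1# +_) -0#≈0#) (+-identityʳ _))
  embed-⊖ (suc m) (suc n) = begin
    embed (suc m ⊖ suc n)            ≡⟨ cong embed (ℤ.[1+m]⊖[1+n]≡m⊖n m n) ⟩
    embed (m ⊖ n)                    ≡⟨ embed-⊖ m n ⟩
    m · 1# - n · 1#                  ≡⟨ sym (cancel-1 _ _) ⟩
    (1# + m · 1#) - (1# + n · 1#)    ≡⟨ cong₂ _-_ (sym (1+× m 1#)) (sym (1+× n 1#)) ⟩
    suc m · 1# - suc n · 1#          ∎

  embed-+ : ∀ x y → embed (x ℤ.+ y) ≡ embed x + embed y
  embed-+ (ℤ.+ m)    (ℤ.+ n)    = ×-homo-+ 1# m n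
  embed-+ (ℤ.+ m)    -[1+ n ] = embed-⊖ m (suc n)
  embed-+ -[1+ m ] (ℤ.+ n)    = trans (embed-⊖ n (suc m)) (+-comm _ _)
  embed-+ -[1+ m ] -[1+ n ] = begin
    - ((2 ℕ.+ (m ℕ.+ n)) · 1#)          ≡⟨ cong (λ k → - (k · 1#)) (sym (cong suc (ℕ.+-suc m n))) ⟩
    - ((suc m ℕ.+ suc n) · 1#)          ≡⟨ cong -_ (×-homo-+ 1# (suc m) (suc n)) ⟩
    - (suc m · 1# + suc n · 1#)         ≡⟨ sym (-‿+-comm _ _) ⟩
    - (suc m · 1#) + - (suc n · 1#)     ∎

  embed-+◃ : ∀ n → embed (Sign.+ ℤ.◃ n) ≡ n · 1#
  embed-+◃ n = cong embed (ℤ.+◃n≡+n n)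

  embed--◃ : ∀ n → embed (Sign.- ℤ.◃ n) ≡ - (n · 1#)
  embed--◃ n = trans (cong embed (ℤ.-◃n≡-n n)) (embed-neg (ℤ.+ n))

  embed-* : ∀ x y → embed (x ℤ.* y) ≡ embed x * embed y
  embed-* (ℤ.+ m) (ℤ.+ n) = trans (embed-+◃ (m ℕ.* n)) (×1-homo-* m n)
  embed-* (ℤ.+ m) -[1+ n ] = begin
    embed (Sign.- ℤ.◃ m ℕ.* suc n)  ≡⟨ embed--◃ (m ℕ.* suc n) ⟩
    - ((m ℕ.* suc n) · 1#)          ≡⟨ cong -_ (×1-homo-* m (suc n)) ⟩
    - (m · 1# * (suc n · 1#))       ≡⟨ -‿distribʳ-* _ _ ⟩
    m · 1# * - (suc n · 1#)         ∎
  embed-* -[1+ m ] (ℤ.+ n) = begin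
    embed (Sign.- ℤ.◃ suc m ℕ.* n)  ≡⟨ embed--◃ (suc m ℕ.* n) ⟩
    - ((suc m ℕ.* n) · 1#)          ≡⟨ cong -_ (×1-homo-* (suc m) n) ⟩
    - (suc m · 1# * (n · 1#))       ≡⟨ -‿distribˡ-* _ _ ⟩
    - (suc m · 1#) * (n · 1#)       ∎
  embed-* -[1+ m ] -[1+ n ] = begin
    embed (Sign.+ ℤ.◃ suc m ℕ.* suc n)    ≡⟨ embed-+◃ (suc m ℕ.* suc n) ⟩
    (suc m ℕ.* suc n) · 1#                ≡⟨ ×1-homo-* (suc m) (suc n) ⟩
    suc m · 1# * (suc n · 1#)             ≡⟨ sym (-‿involutive _) ⟩
    - - (suc m · 1# * (suc n · 1#))       ≡⟨ cong -_ (-‿distribˡ-* _ _) ⟩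
    - (- (suc m · 1#) * (suc n · 1#))     ≡⟨ -‿distribʳ-* _ _ ⟩
    - (suc m · 1#) * - (suc n · 1#)       ∎

  almostCommutativeRing : AlmostCommutativeRing _ _
  almostCommutativeRing = fromCommutativeRing commutativeRing

  homomorphism : ℤ.+-*-rawRing -Raw-AlmostCommutative⟶ almostCommutativeRing
  homomorphism = record
    { ⟦_⟧ = embed ; +-homo = embed-+ ; *-homo = embed-* ; -‿homo = embed-neg
    ; 0-homo = refl ; 1-homo = refl }

  embed≟ : ∀ x y → Maybe (embed x ≡ embed y)
  embed≟ x y with x ℤ.≟ y
  ... | yes x≡y = just (cong embed x≡y)
  ... | no  _   = nothing

  open RingSolver ℤ.+-*-rawRing almostCommutativeRing homomorphism embed≟ public
    using (solve; con; _:=_; _:+_; _:*_; _:-_; :-_)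

-- Ordered-field arithmetic and finite sums.

module FieldProperties (𝓕 : OrderedField) where
  open OrderedField 𝓕
  open IntegerCoefficientSolver 𝓕 public using (solve; con; _:=_; _:+_; _:*_; _:-_; :-_)
  open CommutativeRing commutativeRing public
    using (+-comm; +-assoc; *-comm; *-assoc; +-identityˡ; +-identityʳ; *-identityˡ; *-identityʳ; zeroˡ; zeroʳ; -‿inverseʳ; distribˡ)
  open IsDecTotalOrder isDecTotalOrder public
    using ()
    renaming (refl to ≤-refl; trans to ≤-trans; antisym to ≤-antisym; total to ≤-total; reflexive to ≤-reflexive; _≟_ to _≟ℝ_)
  open SemiringSum (CommutativeRing.semiring commutativeRing) public
    using (sum-cong-≗; sum-replicate-zero; ∑-distrib-+; ∑-comm)
  open SemiringSum (CommutativeRing.semiring commutativeRing)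
    using (*-distribˡ-sum; *-distribʳ-sum)
  open AbelianGroupProperties (CommutativeRing.+-abelianGroup commutativeRing) public
    using () renaming (x∙y⁻¹≈ε⇒x≈y to x-y≡0⇒x≡y)

  poset : Poset 0ℓ 0ℓ 0ℓ
  poset = record { isPartialOrder = IsDecTotalOrder.isPartialOrder isDecTotalOrder }

  module ≤-Reasoning = PartialOrderReasoning poset

  2# : ℝ
  2# = 1# + 1#

  +-monoʳ-≤ : ∀ {x y} z → x ≤ y → z + x ≤ z + y
  +-monoʳ-≤ z x≤y = subst₂ _≤_ (+-comm _ z) (+-comm _ z) (+-monoˡ-≤ z x≤y)

  +-mono-≤ : ∀ {a b x y} → a ≤ b → x ≤ y → a + x ≤ b + y
  +-mono-≤ a≤b x≤y = ≤-trans (+-monoˡ-≤ _ a≤b) (+-monoʳ-≤ _ x≤y)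

  +-cancelʳ-≤ : ∀ {x y} z → x + z ≤ y + z → x ≤ y
  +-cancelʳ-≤ z p = subst₂ _≤_ (cancel _ z) (cancel _ z) (+-monoˡ-≤ (- z) p)
    where
    cancel : ∀ x z → (x + z) + - z ≡ x
    cancel = solve 2 (λ x z → (x :+ z) :+ :- z := x) refl

  x≤y⇒0≤y-x : ∀ {x y} → x ≤ y → 0# ≤ y - x
  x≤y⇒0≤y-x {x} p = subst (_≤ _) (-‿inverseʳ x) (+-monoˡ-≤ (- x) p)

  0≤y-x⇒x≤y : ∀ {x y} → 0# ≤ y - x → x ≤ y
  0≤y-x⇒x≤y {x} {y} p = subst₂ _≤_ (+-identityˡ x)
    (solve 2 (λ x y → (y :- x) :+ x := y) refl x y) (+-monoˡ-≤ x p)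

  neg-mono-≤ : ∀ {x y} → x ≤ y → - y ≤ - x
  neg-mono-≤ {x} {y} p = 0≤y-x⇒x≤y (subst (0# ≤_)
    (solve 2 (λ x y → y :- x := :- x :- :- y) refl x y) (x≤y⇒0≤y-x p))

  *-monoˡ-≤ : ∀ {x y z} → 0# ≤ z → x ≤ y → z * x ≤ z * y
  *-monoˡ-≤ {x} {y} {z} 0≤z p = 0≤y-x⇒x≤y (subst (0# ≤_)
    (solve 3 (λ x y z → z :* (y :- x) := z :* y :- z :* x) refl x y z)
    (*-nonneg 0≤z (x≤y⇒0≤y-x p)))

  *-monoʳ-≤ : ∀ {x y z} → 0# ≤ z → x ≤ y → x * z ≤ y * z
  *-monoʳ-≤ 0≤z p = subst₂ _≤_ (*-comm _ _) (*-comm _ _) (*-monoˡ-≤ 0≤z p)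

  +-nonneg : ∀ {x y} → 0# ≤ x → 0# ≤ y → 0# ≤ x + y
  +-nonneg p q = subst (_≤ _) (+-identityˡ 0#) (+-mono-≤ p q)

  x≤x+nonneg : ∀ {x y} → 0# ≤ y → x ≤ x + y
  x≤x+nonneg {x} {y} p = subst (_≤ x + y) (+-identityʳ x) (+-monoʳ-≤ x p)

  square-nonneg : ∀ x → 0# ≤ x * x
  square-nonneg x with ≤-total 0# x
  ... | inj₁ 0≤x = *-nonneg 0≤x 0≤x
  ... | inj₂ x≤0 = subst (0# ≤_) (solve 1 (λ x → (con (ℤ.+ 0) :- x) :* (con (ℤ.+ 0) :- x) := x :* x) refl x)
                     (*-nonneg (x≤y⇒0≤y-x x≤0) (x≤y⇒0≤y-x x≤0))

  0≤1 : 0# ≤ 1#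
  0≤1 = subst (0# ≤_) (*-identityˡ 1#) (square-nonneg 1#)

  ≰⇒≥ : ∀ {x y} → ¬ (x ≤ y) → y ≤ x
  ≰⇒≥ {x} {y} ¬p = [ (λ p → contradiction p ¬p) , (λ q → q) ]′ (≤-total x y)

  ≰⇒> : ∀ {x y} → ¬ (x ≤ y) → y < x
  ≰⇒> ¬p = ≰⇒≥ ¬p , λ y≡x → ¬p (≤-reflexive (sym y≡x))

  <⇒≱ : ∀ {x y} → x < y → ¬ (y ≤ x)
  <⇒≱ (x≤y , x≢y) y≤x = x≢y (≤-antisym x≤y y≤x)

  <-≤-trans : ∀ {x y z} → x < y → y ≤ z → x < z
  <-≤-trans x<y y≤z = ≰⇒> λ z≤x → <⇒≱ x<y (≤-trans y≤z z≤x)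

  ≤-<-trans : ∀ {x y z} → x ≤ y → y < z → x < z
  ≤-<-trans x≤y y<z = ≰⇒> λ z≤x → <⇒≱ y<z (≤-trans z≤x x≤y)

  +-mono-< : ∀ {a b x y} → a < b → x < y → a + x < b + y
  +-mono-< {a} {b} {x} {y} a<b x<y = ≰⇒> λ p →
    <⇒≱ a<b (+-cancelʳ-≤ y (≤-trans p (+-monoʳ-≤ a (proj₁ x<y))))

  0<1 : 0# < 1#
  0<1 = 0≤1 , 0≢1

  0<2 : 0# < 2#
  0<2 = <-≤-trans 0<1 (x≤x+nonneg 0≤1)

  positive≢0 : ∀ {x} → 0# < x → x ≢ 0#
  positive≢0 (_ , 0≢x) x≡0 = 0≢x (sym x≡0)

  *-inverseˡ : ∀ x → x ≢ 0# → x ⁻¹ * x ≡ 1#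
  *-inverseˡ x x≢0 = trans (*-comm _ _) (*-inverseʳ x x≢0)

  x*y≡0⇒y≡0 : ∀ {x y} → x ≢ 0# → x * y ≡ 0# → y ≡ 0#
  x*y≡0⇒y≡0 {x} {y} x≢0 p = begin
    y              ≡⟨ sym (*-identityˡ y) ⟩
    1# * y         ≡⟨ cong (_* y) (sym (*-inverseˡ x x≢0)) ⟩
    x ⁻¹ * x * y   ≡⟨ *-assoc _ _ _ ⟩
    x ⁻¹ * (x * y) ≡⟨ cong (x ⁻¹ *_) p ⟩
    x ⁻¹ * 0#      ≡⟨ zeroʳ _ ⟩
    0#             ∎
    where open ≡-Reasoning

  *-cancelˡ : ∀ {x y z} → x ≢ 0# → x * y ≡ x * z → y ≡ z
  *-cancelˡ {x} {y} {z} x≢0 p = x-y≡0⇒x≡y y z (x*y≡0⇒y≡0 x≢0 (begin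
    x * (y - z)     ≡⟨ solve 3 (λ x y z → x :* (y :- z) := x :* y :- x :* z) refl x y z ⟩
    x * y - x * z   ≡⟨ cong (_- x * z) p ⟩
    x * z - x * z   ≡⟨ -‿inverseʳ _ ⟩
    0#              ∎))
    where open ≡-Reasoning

  ⁻¹-unique : ∀ {x y} → x * y ≡ 1# → x ⁻¹ ≡ y
  ⁻¹-unique {x} {y} p = *-cancelˡ x≢0 (trans (*-inverseʳ x x≢0) (sym p))
    where
    x≢0 : x ≢ 0#
    x≢0 x≡0 = 0≢1 (trans (sym (zeroˡ y)) (trans (cong (_* y) (sym x≡0)) p))

  *-positive : ∀ {x y} → 0# < x → 0# < y → 0# < x * y
  *-positive 0<x 0<y = *-nonneg (proj₁ 0<x) (proj₁ 0<y) , λ 0≡xy →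
    positive≢0 0<y (x*y≡0⇒y≡0 (positive≢0 0<x) (sym 0≡xy))

  ⁻¹-nonneg : ∀ {x} → 0# < x → 0# ≤ x ⁻¹
  ⁻¹-nonneg {x} 0<x = subst (0# ≤_) (begin
    x * (x ⁻¹ * x ⁻¹) ≡⟨ sym (*-assoc _ _ _) ⟩
    x * x ⁻¹ * x ⁻¹   ≡⟨ cong (_* x ⁻¹) (*-inverseʳ x (positive≢0 0<x)) ⟩
    1# * x ⁻¹         ≡⟨ *-identityˡ _ ⟩
    x ⁻¹              ∎)
    (*-nonneg (proj₁ 0<x) (square-nonneg _))
    where open ≡-Reasoning

  ⁻¹-positive : ∀ {x} → 0# < x → 0# < x ⁻¹
  ⁻¹-positive {x} 0<x = ⁻¹-nonneg 0<x , λ 0≡x⁻¹ →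
    0≢1 (trans (sym (zeroʳ x)) (trans (cong (x *_) 0≡x⁻¹) (*-inverseʳ x (positive≢0 0<x))))

  *-cancelˡ-≤ : ∀ {x y z} → 0# < z → z * x ≤ z * y → x ≤ y
  *-cancelˡ-≤ {x} {y} {z} 0<z p = subst₂ _≤_ (cancel x) (cancel y) (*-monoˡ-≤ (⁻¹-nonneg 0<z) p)
    where
    open ≡-Reasoning
    cancel : ∀ t → z ⁻¹ * (z * t) ≡ t
    cancel t = begin
      z ⁻¹ * (z * t) ≡⟨ sym (*-assoc _ _ _) ⟩
      z ⁻¹ * z * t   ≡⟨ cong (_* t) (*-inverseˡ z (positive≢0 0<z)) ⟩
      1# * t         ≡⟨ *-identityˡ t ⟩
      t              ∎

  fromℕ-nonneg : ∀ n → 0# ≤ fromℕ n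
  fromℕ-nonneg zero    = ≤-refl
  fromℕ-nonneg (suc n) = +-nonneg 0≤1 (fromℕ-nonneg n)

  fromℕ-mono : ∀ {m n} → m ℕ.≤ n → fromℕ m ≤ fromℕ n
  fromℕ-mono {n = n} ℕ.z≤n = fromℕ-nonneg n
  fromℕ-mono (ℕ.s≤s m≤n) = +-monoʳ-≤ 1# (fromℕ-mono m≤n)

  sum-mono : ∀ {n} {f g : Fin n → ℝ} → (∀ i → f i ≤ g i) → sum f ≤ sum g
  sum-mono {zero}  p = ≤-refl
  sum-mono {suc n} p = +-mono-≤ (p zero) (sum-mono (p ∘ suc))

  sum-nonneg : ∀ {n} {f : Fin n → ℝ} → (∀ i → 0# ≤ f i) → 0# ≤ sum f
  sum-nonneg {zero}  p = ≤-refl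
  sum-nonneg {suc n} p = +-nonneg (p zero) (sum-nonneg (p ∘ suc))

  term≤sum : ∀ {n} {f : Fin n → ℝ} → (∀ i → 0# ≤ f i) → ∀ i → f i ≤ sum f
  term≤sum p zero    = x≤x+nonneg (sum-nonneg (p ∘ suc))
  term≤sum {f = f} p (suc i) = ≤-trans (term≤sum (p ∘ suc) i)
    (subst (_≤ sum f) (+-identityˡ _) (+-monoˡ-≤ (sum (f ∘ suc)) (p zero)))

  sum≡0⇒term≡0 : ∀ {n} {f : Fin n → ℝ} → (∀ i → 0# ≤ f i) → sum f ≡ 0# → ∀ i → f i ≡ 0#
  sum≡0⇒term≡0 p sum≡0 i = ≤-antisym (subst (_ ≤_) sum≡0 (term≤sum p i)) (p i)

  sum-zero : ∀ {n} {f : Fin n → ℝ} → (∀ i → f i ≡ 0#) → sum f ≡ 0#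
  sum-zero {n} p = trans (sum-cong-≗ p) (sum-replicate-zero n)

  sum-neg : ∀ {n} (f : Fin n → ℝ) → sum (λ i → - f i) ≡ - sum f
  sum-neg {zero}  f = solve 0 (con (ℤ.+ 0) := :- con (ℤ.+ 0)) refl
  sum-neg {suc n} f = trans (cong (- f zero +_) (sum-neg (f ∘ suc)))
    (solve 2 (λ x y → :- x :+ :- y := :- (x :+ y)) refl (f zero) _)

  sum-- : ∀ {n} (f g : Fin n → ℝ) → sum (λ i → f i - g i) ≡ sum f - sum g
  sum-- f g = trans (∑-distrib-+ f (λ i → - g i)) (cong (sum f +_) (sum-neg g))

  *-sumˡ : ∀ {n} x (f : Fin n → ℝ) → x * sum f ≡ sum (λ i → x * f i)
  *-sumˡ {n} x f = *-distribˡ-sum {n} x f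

  *-sumʳ : ∀ {n} x (f : Fin n → ℝ) → sum f * x ≡ sum (λ i → f i * x)
  *-sumʳ {n} x f = *-distribʳ-sum {n} x f

  kronecker : ∀ {n} → Fin n → Fin n → ℝ
  kronecker i k = if does (i Fin.≟ k) then 1# else 0#

  kronecker-refl : ∀ {n} (i : Fin n) → kronecker i i ≡ 1#
  kronecker-refl i = cong (if_then 1# else 0#) (dec-true (i Fin.≟ i) refl)

  kronecker-≢ : ∀ {n} {i k : Fin n} → i ≢ k → kronecker i k ≡ 0#
  kronecker-≢ {i = i} {k} i≢k = cong (if_then 1# else 0#) (dec-false (i Fin.≟ k) i≢k)

  kronecker-sym : ∀ {n} (i k : Fin n) → kronecker i k ≡ kronecker k i
  kronecker-sym i k with i Fin.≟ k
  ... | yes refl = sym (kronecker-refl i)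
  ... | no  i≢k  = sym (kronecker-≢ (i≢k ∘ sym))

  sum-kronecker : ∀ {n} i (f : Fin n → ℝ) → sum (λ k → kronecker i k * f k) ≡ f i
  sum-kronecker zero    f = trans (cong₂ _+_ (*-identityˡ _) (sum-zero (λ k → zeroˡ (f (suc k))))) (+-identityʳ _)
  sum-kronecker (suc i) f = trans (cong₂ _+_ (zeroˡ _) (sum-kronecker i (f ∘ suc))) (+-identityˡ _)

  -- The `Fin n` argument excludes the empty domain.
  argmax : ∀ {n} (u : Fin n → ℝ) → Fin n → ∃[ m ] (∀ x → u x ≤ u m)
  argmax {suc zero}    u _ = zero , λ { zero → ≤-refl }
  argmax {suc (suc n)} u _ with argmax (u ∘ suc) zero
  ... | m , max with ≤-total (u zero) (u (suc m))
  ...   | inj₁ p = suc m , λ { zero → p ; (suc x) → max x }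
  ...   | inj₂ p = zero  , λ { zero → ≤-refl ; (suc x) → ≤-trans (max x) p }

  -- Variance: Σ p (a − m)² ≥ 0 for m = Σ p a.
  jensen : ∀ {n} {p : Fin n → ℝ} (a : Fin n → ℝ) → (∀ y → 0# ≤ p y) → sum p ≤ 1# →
           sum (λ y → p y * a y) * sum (λ y → p y * a y) ≤ sum (λ y → p y * (a y * a y))
  jensen {p = p} a 0≤p Σp≤1 = 0≤y-x⇒x≤y (subst (0# ≤_) expand
      (+-nonneg (sum-nonneg λ y → *-nonneg (0≤p y) (square-nonneg (a y - m)))
                (*-nonneg (square-nonneg m) (x≤y⇒0≤y-x Σp≤1))))
    where
    m q r : ℝ
    m = sum (λ y → p y * a y)
    q = sum (λ y → p y * (a y * a y))
    r = m * m * (1# - sum p)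
    open ≡-Reasoning
    expand : sum (λ y → p y * ((a y - m) * (a y - m))) + r ≡ q - m * m
    expand = begin
      sum (λ y → p y * ((a y - m) * (a y - m))) + r
        ≡⟨ cong (_+ r) (sum-cong-≗ λ y → solve 3 (λ p a m → p :* ((a :- m) :* (a :- m)) :=
             p :* (a :* a) :+ ((con (ℤ.+ 0) :- (m :+ m)) :* (p :* a) :+ m :* m :* p)) refl (p y) (a y) m) ⟩
      sum (λ y → p y * (a y * a y) + ((0# - (m + m)) * (p y * a y) + m * m * p y)) + r
        ≡⟨ cong (_+ r) (trans (∑-distrib-+ (λ y → p y * (a y * a y)) _) (cong (q +_) (∑-distrib-+ (λ y → (0# - (m + m)) * (p y * a y)) _))) ⟩
      q + (sum (λ y → (0# - (m + m)) * (p y * a y)) + sum (λ y → m * m * p y)) + r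
        ≡⟨ cong (λ z → q + z + r) (cong₂ _+_ (sym (*-sumˡ (0# - (m + m)) (λ y → p y * a y))) (sym (*-sumˡ (m * m) p))) ⟩
      q + ((0# - (m + m)) * m + m * m * sum p) + r
        ≡⟨ solve 3 (λ q m s → q :+ ((con (ℤ.+ 0) :- (m :+ m)) :* m :+ m :* m :* s) :+ m :* m :* (con (ℤ.+ 1) :- s) := q :- m :* m) refl q m (sum p) ⟩
      q - m * m ∎

  ∣∣<-intro : ∀ {x ε} → x < ε → - x < ε → ∣ x ∣ < ε
  ∣∣<-intro {x} p q with 0# ≤? x
  ... | yes _ = p
  ... | no  _ = q

  ∣∣<⇒< : ∀ {x ε} → ∣ x ∣ < ε → x < ε
  ∣∣<⇒< {x} p with 0# ≤? x
  ... | yes _   = p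
  ... | no  0≰x = ≤-<-trans x≤-x p
    where
    x≤0 : x ≤ 0#
    x≤0 = ≰⇒≥ 0≰x
    x≤-x : x ≤ - x
    x≤-x = ≤-trans x≤0 (subst (_≤ - x) (solve 0 (:- con (ℤ.+ 0) := con (ℤ.+ 0)) refl) (neg-mono-≤ x≤0))

  ∣∣<⇒-< : ∀ {x ε} → ∣ x ∣ < ε → - x < ε
  ∣∣<⇒-< {x} p with 0# ≤? x
  ... | no  _   = p
  ... | yes 0≤x = ≤-<-trans (≤-trans (subst (- x ≤_) (solve 0 (:- con (ℤ.+ 0) := con (ℤ.+ 0)) refl) (neg-mono-≤ 0≤x)) 0≤x) p

-- Limits and series.

module Limits (𝓡 : RealNumbers) where
  open RealNumbers 𝓡
  open FieldProperties orderedField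

  half : ℝ → ℝ
  half ε = ε * 2# ⁻¹

  half+half : ∀ ε → half ε + half ε ≡ ε
  half+half ε = begin
    ε * 2# ⁻¹ + ε * 2# ⁻¹  ≡⟨ solve 2 (λ e t → e :* t :+ e :* t := e :* ((con (ℤ.+ 1) :+ con (ℤ.+ 1)) :* t)) refl ε (2# ⁻¹) ⟩
    ε * (2# * 2# ⁻¹)       ≡⟨ cong (ε *_) (*-inverseʳ 2# (positive≢0 0<2)) ⟩
    ε * 1#                 ≡⟨ *-identityʳ ε ⟩
    ε                      ∎
    where open ≡-Reasoning

  half-positive : ∀ {ε} → 0# < ε → 0# < half ε
  half-positive 0<ε = *-positive 0<ε (⁻¹-positive 0<2)

  <-half+half : ∀ {x y ε} → x < half ε → y < half ε → x + y < ε
  <-half+half p q = subst (_ <_) (half+half _) (+-mono-< p q)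

  ⟶-cong : ∀ {s t l} → (∀ n → s n ≡ t n) → s ⟶ l → t ⟶ l
  ⟶-cong s≡t s⟶l ε 0<ε with s⟶l ε 0<ε
  ... | N , p = N , λ n N≤n → subst (λ x → ∣ x - _ ∣ < ε) (s≡t n) (p n N≤n)

  ⟶-eventually-const : ∀ {s l} N → (∀ n → N ℕ.≤ n → s n ≡ l) → s ⟶ l
  ⟶-eventually-const {s} {l} N s≡l ε 0<ε = N , λ n N≤n →
    subst (λ x → ∣ x ∣ < ε) (sym (trans (cong (_- l) (s≡l n N≤n)) (-‿inverseʳ l)))
      (∣∣<-intro 0<ε (subst (_< ε) (solve 0 (con (ℤ.+ 0) := :- con (ℤ.+ 0)) refl) 0<ε))

  ⟶-const : ∀ l → (λ _ → l) ⟶ l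
  ⟶-const l = ⟶-eventually-const 0 λ _ _ → refl

  -- If `m < l`, some index puts the sequence within half of `l - m` of both limits, which gives
  -- `l - m < l - m`.
  ⟶-unique : ∀ {s l m} → s ⟶ l → s ⟶ m → l ≡ m
  ⟶-unique {s} {l} {m} s⟶l s⟶m = ≤-antisym (l≤m s⟶l s⟶m) (l≤m s⟶m s⟶l)
    where
    l≤m : ∀ {l m} → s ⟶ l → s ⟶ m → l ≤ m
    l≤m {l} {m} s⟶l s⟶m with l ≤? m
    ... | yes p = p
    ... | no ¬p = contradiction (≤-reflexive refl) (<⇒≱ l-m<l-m)
      where
      m<l : m < l
      m<l = ≰⇒> ¬p
      0<l-m : 0# < l - m
      0<l-m = x≤y⇒0≤y-x (proj₁ m<l) , λ 0≡l-m → proj₂ m<l (sym (x-y≡0⇒x≡y l m (sym 0≡l-m)))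
      N₁ = s⟶l _ (half-positive 0<l-m)
      N₂ = s⟶m _ (half-positive 0<l-m)
      k : ℕ
      k = proj₁ N₁ ℕ.+ proj₁ N₂
      l-m<l-m : l - m < l - m
      l-m<l-m = subst (_< l - m)
        (solve 3 (λ s l m → :- (s :- l) :+ (s :- m) := l :- m) refl (s k) l m)
        (<-half+half (∣∣<⇒-< (proj₂ N₁ k (ℕ.m≤m+n _ _))) (∣∣<⇒< (proj₂ N₂ k (ℕ.m≤n+m _ (proj₁ N₁)))))

  ⟶-+ : ∀ {s t l m} → s ⟶ l → t ⟶ m → (λ n → s n + t n) ⟶ l + m
  ⟶-+ {s} {t} {l} {m} s⟶l t⟶m ε 0<ε = proj₁ N₁ ℕ.+ proj₁ N₂ , λ n N≤n →
    let p = proj₂ N₁ n (ℕ.≤-trans (ℕ.m≤m+n _ _) N≤n)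
        q = proj₂ N₂ n (ℕ.≤-trans (ℕ.m≤n+m _ (proj₁ N₁)) N≤n)
    in subst (λ x → ∣ x ∣ < ε)
      (solve 4 (λ s t l m → (s :- l) :+ (t :- m) := (s :+ t) :- (l :+ m)) refl (s n) (t n) l m)
      (∣∣<-intro (<-half+half (∣∣<⇒< p) (∣∣<⇒< q))
        (subst (_< ε) (solve 2 (λ x y → :- x :+ :- y := :- (x :+ y)) refl (s n - l) (t n - m))
          (<-half+half (∣∣<⇒-< p) (∣∣<⇒-< q))))
    where
    N₁ = s⟶l _ (half-positive 0<ε)
    N₂ = t⟶m _ (half-positive 0<ε)

  ⟶-neg : ∀ {s l} → s ⟶ l → (λ n → - s n) ⟶ - l
  ⟶-neg {s} {l} s⟶l ε 0<ε = proj₁ N , λ n N≤n → ∣∣<-intro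
    (subst (_< ε) (solve 2 (λ s l → :- (s :- l) := :- s :- :- l) refl (s n) l) (∣∣<⇒-< (proj₂ N n N≤n)))
    (subst (_< ε) (solve 2 (λ s l → s :- l := :- (:- s :- :- l)) refl (s n) l) (∣∣<⇒< (proj₂ N n N≤n)))
    where N = s⟶l ε 0<ε

  private
    ⟶-*-nonneg : ∀ {c s l} → 0# ≤ c → s ⟶ l → (λ n → c * s n) ⟶ c * l
    ⟶-*-nonneg {c} {s} {l} 0≤c s⟶l ε 0<ε = proj₁ N , λ n N≤n → ∣∣<-intro
        (scale (solve 3 (λ c s l → c :* (s :- l) := c :* s :- c :* l) refl c (s n) l) (∣∣<⇒< (proj₂ N n N≤n)))
        (scale (solve 3 (λ c s l → c :* (:- (s :- l)) := :- (c :* s :- c :* l)) refl c (s n) l) (∣∣<⇒-< (proj₂ N n N≤n)))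
      where
      0<1+c : 0# < 1# + c
      0<1+c = <-≤-trans 0<1 (x≤x+nonneg 0≤c)
      -- Dividing by `1# + c` instead of `c` also covers `c = 0`, and the surplus `δ` makes the
      -- final inequality strict.
      δ : ℝ
      δ = ε * (1# + c) ⁻¹
      0<δ : 0# < δ
      0<δ = *-positive 0<ε (⁻¹-positive 0<1+c)
      δ+cδ≡ε : δ + c * δ ≡ ε
      δ+cδ≡ε = begin
        ε * i + c * (ε * i)     ≡⟨ solve 3 (λ e i c → e :* i :+ c :* (e :* i) := e :* ((con (ℤ.+ 1) :+ c) :* i)) refl ε i c ⟩
        ε * ((1# + c) * i)      ≡⟨ cong (ε *_) (*-inverseʳ (1# + c) (positive≢0 0<1+c)) ⟩
        ε * 1#                  ≡⟨ *-identityʳ ε ⟩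
        ε                       ∎
        where
        open ≡-Reasoning
        i = (1# + c) ⁻¹
      N = s⟶l δ 0<δ
      scale : ∀ {x y} → c * x ≡ y → x < δ → y < ε
      scale refl x<δ = ≤-<-trans (*-monoˡ-≤ 0≤c (proj₁ x<δ))
        (subst₂ _<_ (+-identityˡ _) δ+cδ≡ε
          (≰⇒> λ p → <⇒≱ 0<δ (+-cancelʳ-≤ (c * δ) p)))

  ⟶-* : ∀ c {s l} → s ⟶ l → (λ n → c * s n) ⟶ c * l
  ⟶-* c {s} {l} s⟶l with 0# ≤? c
  ... | yes 0≤c = ⟶-*-nonneg 0≤c s⟶l
  ... | no  0≰c = subst ((λ n → c * s n) ⟶_) (neg*neg c l)
    (⟶-cong (λ n → neg*neg c (s n)) (⟶-*-nonneg 0≤-c (⟶-neg s⟶l)))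
    where
    neg*neg : ∀ c x → - c * - x ≡ c * x
    neg*neg = solve 2 (λ c x → :- c :* :- x := c :* x) refl
    0≤-c : 0# ≤ - c
    0≤-c = subst (_≤ - c) (solve 0 (:- con (ℤ.+ 0) := con (ℤ.+ 0)) refl) (neg-mono-≤ (≰⇒≥ 0≰c))

  ⟶-sum : ∀ {m} {s : ℕ → Fin m → ℝ} {l : Fin m → ℝ} → (∀ y → (λ n → s n y) ⟶ l y) →
          (λ n → sum (s n)) ⟶ sum l
  ⟶-sum {zero}  p = ⟶-const 0#
  ⟶-sum {suc m} p = ⟶-+ (p zero) (⟶-sum (p ∘ suc))

  ⟶-suc : ∀ {s l} → s ⟶ l → (s ∘ suc) ⟶ l
  ⟶-suc s⟶l ε 0<ε with s⟶l ε 0<ε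
  ... | N , p = N , λ n N≤n → p (suc n) (ℕ.m≤n⇒m≤1+n N≤n)

  ⟶-pred : ∀ {s l} → (s ∘ suc) ⟶ l → s ⟶ l
  ⟶-pred s⟶l ε 0<ε with s⟶l ε 0<ε
  ... | N , p = suc N , λ { (suc n) (ℕ.s≤s N≤n) → p n N≤n }

  -- `lim` is specified on Cauchy sequences alone, so the convergent sequence is shown to be Cauchy
  -- before `complete` and uniqueness identify the two limits.
  ⟶⇒lim : ∀ {s l} → s ⟶ l → lim s ≡ l
  ⟶⇒lim {s} {l} s⟶l = ⟶-unique (complete s cauchy) s⟶l
    where
    cauchy : Cauchy s
    cauchy ε 0<ε = proj₁ N , λ m n N≤m N≤n →
        let p = proj₂ N m N≤m
            q = proj₂ N n N≤n
        in ∣∣<-intro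
          (subst (_< ε) (solve 3 (λ s t l → (s :- l) :+ :- (t :- l) := s :- t) refl (s m) (s n) l)
            (<-half+half (∣∣<⇒< p) (∣∣<⇒-< q)))
          (subst (_< ε) (solve 3 (λ s t l → :- (s :- l) :+ (t :- l) := :- (s :- t)) refl (s m) (s n) l)
            (<-half+half (∣∣<⇒-< p) (∣∣<⇒< q)))
      where N = s⟶l _ (half-positive 0<ε)

  0⟵-intro : ∀ {s} → (∀ ε → 0# < ε → ∃[ N ] (∀ n → N ℕ.≤ n → s n < ε × - s n < ε)) → s ⟶ 0#
  0⟵-intro {s} p ε 0<ε with p ε 0<ε
  ... | N , q = N , λ n N≤n → subst (λ x → ∣ x ∣ < ε) (solve 1 (λ x → x := x :- con (ℤ.+ 0)) refl (s n))
    (∣∣<-intro (proj₁ (q n N≤n)) (proj₂ (q n N≤n)))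

  0⟵⇒< : ∀ {s} → s ⟶ 0# → ∀ ε → 0# < ε → ∃[ N ] (∀ n → N ℕ.≤ n → s n < ε)
  0⟵⇒< {s} s⟶0 ε 0<ε with s⟶0 ε 0<ε
  ... | N , p = N , λ n N≤n → subst (_< ε) (solve 1 (λ x → x :- con (ℤ.+ 0) := x) refl (s n)) (∣∣<⇒< (p n N≤n))

  -- The Archimedean axiom gives `k ≥ B / ε`. If `φ n` were at least `ε` for some `n > k`, then
  -- `1 + k ≤ n ≤ B / ε ≤ k`.
  fromℕ*-bounded⇒0⟵ : ∀ {φ B} → (∀ n → 0# ≤ φ n) → (∀ n → fromℕ n * φ n ≤ B) → φ ⟶ 0#
  fromℕ*-bounded⇒0⟵ {φ} {B} 0≤φ bounded = 0⟵-intro λ ε 0<ε → claim ε 0<ε (archimedean (B * ε ⁻¹))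
    where
    claim : ∀ ε → 0# < ε → ∃[ k ] B * ε ⁻¹ ≤ fromℕ k → ∃[ N ] (∀ n → N ℕ.≤ n → φ n < ε × - φ n < ε)
    claim ε 0<ε (k , B/ε≤k) = suc k , λ n k<n → φ<ε n k<n ,
        ≤-<-trans (subst (- φ n ≤_) (solve 0 (:- con (ℤ.+ 0) := con (ℤ.+ 0)) refl) (neg-mono-≤ (0≤φ n))) 0<ε
      where
      φ<ε : ∀ n → k ℕ.< n → φ n < ε
      φ<ε n k<n = ≰⇒> λ ε≤φ → <⇒≱ 0<1 (+-cancelʳ-≤ (fromℕ k) (begin
        1# + fromℕ k      ≤⟨ fromℕ-mono k<n ⟩
        fromℕ n           ≤⟨ *-cancelˡ-≤ 0<ε (begin
          ε * fromℕ n          ≡⟨ *-comm _ _ ⟩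
          fromℕ n * ε          ≤⟨ *-monoˡ-≤ (fromℕ-nonneg n) ε≤φ ⟩
          fromℕ n * φ n        ≤⟨ bounded n ⟩
          B                    ≡⟨ sym (*-identityʳ B) ⟩
          B * 1#               ≡⟨ cong (B *_) (sym (*-inverseˡ ε (positive≢0 0<ε))) ⟩
          B * (ε ⁻¹ * ε)       ≡⟨ solve 3 (λ b i e → b :* (i :* e) := e :* (b :* i)) refl B (ε ⁻¹) ε ⟩
          ε * (B * ε ⁻¹)       ∎) ⟩
        B * ε ⁻¹          ≤⟨ B/ε≤k ⟩
        fromℕ k           ≡⟨ sym (+-identityˡ _) ⟩
        0# + fromℕ k      ∎))
        where open ≤-Reasoning

  -- Comparing the square with `ε * ε` takes the place of a square root, so that bounds on squared
  -- norms can be used as they are.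
  square≤⇒0⟵ : ∀ {r φ} → (∀ n → r n * r n ≤ φ n) → φ ⟶ 0# → r ⟶ 0#
  square≤⇒0⟵ {r} {φ} r²≤φ φ⟶0 = 0⟵-intro λ ε 0<ε →
    let N = 0⟵⇒< φ⟶0 (ε * ε) (*-positive 0<ε 0<ε)
    in proj₁ N , λ n N≤n →
       below 0<ε (≤-<-trans (r²≤φ n) (proj₂ N n N≤n)) ,
       below 0<ε (≤-<-trans (subst (_≤ φ n) (solve 1 (λ r → r :* r := :- r :* :- r) refl (r n)) (r²≤φ n)) (proj₂ N n N≤n))
    where
    below : ∀ {x ε} → 0# < ε → x * x < ε * ε → x < ε
    below {x} {ε} 0<ε x²<ε² = ≰⇒> λ ε≤x → <⇒≱ x²<ε²
      (≤-trans (*-monoˡ-≤ (proj₁ 0<ε) ε≤x) (*-monoʳ-≤ (≤-trans (proj₁ 0<ε) ε≤x) ε≤x))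

  partialSums-suc : ∀ f N → partialSums f (suc N) ≡ partialSums f N + f N
  partialSums-suc f zero    = +-comm _ _
  partialSums-suc f (suc N) = trans (cong (f 0 +_) (partialSums-suc (f ∘ suc) N)) (sym (+-assoc _ _ _))

  partialSums-cong : ∀ {f g} → (∀ t → f t ≡ g t) → ∀ N → partialSums f N ≡ partialSums g N
  partialSums-cong f≡g N = sum-cong-≗ {N} λ i → f≡g (toℕ i)

  -- Reduces countable additivity to finite additivity when all events from some index on are null.
  HasSum-finite : ∀ {f s} N → (∀ t → N ℕ.≤ t → f t ≡ 0#) → HasSum f s → s ≡ partialSums f N
  HasSum-finite {f} N f≡0 hasSum = ⟶-unique hasSum (⟶-eventually-const N constant)
    where
    constant : ∀ n → N ℕ.≤ n → partialSums f n ≡ partialSums f N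
    constant n N≤n = go n (ℕ.≤⇒≤′ N≤n)
      where
      go : ∀ n → N ℕ.≤′ n → partialSums f n ≡ partialSums f N
      go _       ℕ.≤′-refl = refl
      go (suc n) (ℕ.≤′-step N≤n) = begin
        partialSums f (suc n)     ≡⟨ partialSums-suc f n ⟩
        partialSums f n + f n     ≡⟨ cong₂ _+_ (go n N≤n) (f≡0 n (ℕ.≤′⇒≤ N≤n)) ⟩
        partialSums f N + 0#      ≡⟨ +-identityʳ _ ⟩
        partialSums f N           ∎
        where open ≡-Reasoning

  HasSum⇒0⟵ : ∀ {f s} → HasSum f s → f ⟶ 0#
  HasSum⇒0⟵ {f} {s} hasSum = subst (f ⟶_) (-‿inverseʳ s)
    (⟶-cong difference (⟶-+ (⟶-suc hasSum) (⟶-neg hasSum)))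
    where
    difference : ∀ n → partialSums f (suc n) + - partialSums f n ≡ f n
    difference n = trans (cong (_+ - partialSums f n) (partialSums-suc f n))
      (solve 2 (λ x y → (x :+ y) :+ :- x := y) refl (partialSums f n) (f n))

  -- All partial sums past `t` are at least `f t`; a positive `f t` would keep them away from 0.
  HasSum-0⇒≡0 : ∀ {f} → (∀ t → 0# ≤ f t) → HasSum f 0# → ∀ t → f t ≡ 0#
  HasSum-0⇒≡0 {f} 0≤f hasSum t = ≤-antisym (f≤0 (f t ≤? 0#)) (0≤f t)
    where
    f≤partialSums : ∀ N → f t ≤ partialSums f (suc t ℕ.+ N)
    f≤partialSums zero = subst (λ k → f t ≤ partialSums f k) (sym (ℕ.+-identityʳ (suc t)))
      (subst (f t ≤_) (trans (+-comm _ _) (sym (partialSums-suc f t)))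
        (x≤x+nonneg (sum-nonneg {t} (λ i → 0≤f (toℕ i)))))
    f≤partialSums (suc N) = subst (λ k → f t ≤ partialSums f k) (sym (ℕ.+-suc (suc t) N))
      (subst (f t ≤_) (sym (partialSums-suc f (suc t ℕ.+ N)))
        (≤-trans (f≤partialSums N) (x≤x+nonneg (0≤f _))))
    f≤0 : Dec (f t ≤ 0#) → f t ≤ 0#
    f≤0 (yes p) = p
    f≤0 (no ¬p) with 0⟵⇒< hasSum (f t) (≰⇒> ¬p)
    ... | N , q = contradiction (f≤partialSums N) (<⇒≱ (q (suc t ℕ.+ N) (ℕ.m≤n+m N (suc t))))

-- The graph Laplacian, its pseudoinverse and the transition matrix.

module Laplacian {𝓡 : RealNumbers} {n d : ℕ} (G : ConnectionGraph 𝓡 n d) where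
  open RealNumbers 𝓡
  open Matrices 𝓡
  open FieldProperties orderedField
  open ConnectionGraph G
  open ≡-Reasoning

  P : Fin n → Fin n → ℝ
  P = transitionProbability

  mean : (Fin n → ℝ) → Fin n → ℝ
  mean u x = sum λ y → P x y * u y

  -- `L u` in difference form (see `L-Δ`): at a maximum of `u` all terms have the same sign, and
  -- additive constants drop out.
  Δ : (Fin n → ℝ) → Fin n → ℝ
  Δ u x = sum λ y → w x y * (u x - u y)

  Δ-affine : ∀ c u x → Δ (λ y → c - u y) x ≡ - Δ u x
  Δ-affine c u x = trans (sum-cong-≗ λ y →
    solve 4 (λ w c a b → w :* ((c :- a) :- (c :- b)) := :- (w :* (a :- b))) refl (w x y) c (u x) (u y))
    (sum-neg (λ y → w x y * (u x - u y)))

  Δ-sum : ∀ {m} (f : Fin m → Fin n → ℝ) x → Δ (λ y → sum λ z → f z y) x ≡ sum λ z → Δ (f z) x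
  Δ-sum {m} f x = begin
    sum (λ y → w x y * (sum (λ z → f z x) - sum (λ z → f z y)))
      ≡⟨ sum-cong-≗ (λ y → trans (cong (w x y *_) (sym (sum-- (λ z → f z x) (λ z → f z y)))) (*-sumˡ (w x y) (λ z → f z x - f z y))) ⟩
    sum (λ y → sum λ z → w x y * (f z x - f z y))
      ≡⟨ ∑-comm {n} {m} _ ⟩
    sum (λ z → sum λ y → w x y * (f z x - f z y)) ∎

  L-Δ : ∀ u x → sum (λ y → L x y * u y) ≡ Δ u x
  L-Δ u x = begin
    sum (λ y → (deg x * I x y - w x y) * u y)
      ≡⟨ sum-cong-≗ (λ y → solve 4 (λ d i w u → (d :* i :- w) :* u := d :* (i :* u) :- w :* u) refl (deg x) (I x y) (w x y) (u y)) ⟩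
    sum (λ y → deg x * (I x y * u y) - w x y * u y)
      ≡⟨ sum-- (λ y → deg x * (I x y * u y)) _ ⟩
    sum (λ y → deg x * (I x y * u y)) - sum (λ y → w x y * u y)
      ≡⟨ cong (_- sum (λ y → w x y * u y)) (trans (sym (*-sumˡ (deg x) (λ y → I x y * u y))) (cong (deg x *_) (sum-kronecker x u))) ⟩
    deg x * u x - sum (λ y → w x y * u y)
      ≡⟨ cong (_- sum (λ y → w x y * u y)) (*-sumʳ (u x) (w x)) ⟩
    sum (λ y → w x y * u x) - sum (λ y → w x y * u y)
      ≡⟨ sym (sum-- (λ y → w x y * u x) _) ⟩
    sum (λ y → w x y * u x - w x y * u y)
      ≡⟨ sum-cong-≗ (λ y → solve 3 (λ w a b → w :* a :- w :* b := w :* (a :- b)) refl (w x y) (u x) (u y)) ⟩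
    Δ u x ∎

  -- Maximum principle: the value at a maximum propagates along edges.
  Δ≡0⇒constant : ∀ u → (∀ x → Δ u x ≡ 0#) → ∀ x y → u x ≡ u y
  Δ≡0⇒constant u Δu≡0 x y = trans (≡max x) (sym (≡max y))
    where
    maximum = argmax u x
    m : Fin n
    m = proj₁ maximum
    propagate : ∀ {x y} → u x ≡ u m → x ∼ y → u y ≡ u m
    propagate {x} {y} ux≡um x∼y = trans
      (sym (x-y≡0⇒x≡y _ _ (x*y≡0⇒y≡0 (positive≢0 x∼y) (sum≡0⇒term≡0 nonneg (Δu≡0 x) y)))) ux≡um
      where
      nonneg : ∀ y → 0# ≤ w x y * (u x - u y)
      nonneg y = *-nonneg (w-nonneg x y) (x≤y⇒0≤y-x (subst (u y ≤_) (sym ux≡um) (proj₂ maximum y)))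
    along : ∀ {x y} → Star _∼_ x y → u x ≡ u m → u y ≡ u m
    along Star.ε   p = p
    along (e ◅ es) p = along es (propagate p e)
    ≡max : ∀ x → u x ≡ u m
    ≡max x = along (connected m x) refl

  L-symmetric : ∀ x y → L x y ≡ L y x
  L-symmetric x y with x Fin.≟ y
  ... | yes refl = cong₂ _-_ (cong (deg x *_) (sym (kronecker-refl x))) refl
  ... | no  x≢y  = cong₂ _-_ (begin
    deg x * 0#     ≡⟨ zeroʳ _ ⟩
    0#             ≡⟨ sym (zeroʳ _) ⟩
    deg y * 0#     ≡⟨ cong (deg y *_) (sym (kronecker-≢ (x≢y ∘ sym))) ⟩
    deg y * I y x  ∎) (w-symmetric x y)

  module _ {L† : Matrix n n} (penrose : IsMoorePenroseInverse L L†) where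
    open IsMoorePenroseInverse penrose

    -- The rows of L L† − I are killed by L, hence constant.
    Δ-potential : ∀ a b x → Δ (λ y → L† y a - L† y b) x ≡ I x a - I x b
    Δ-potential a b x = begin
      Δ (λ y → L† y a - L† y b) x
        ≡⟨ sym (L-Δ (λ y → L† y a - L† y b) x) ⟩
      sum (λ y → L x y * (L† y a - L† y b))
        ≡⟨ sum-cong-≗ (λ y → solve 3 (λ l a b → l :* (a :- b) := l :* a :- l :* b) refl (L x y) (L† y a) (L† y b)) ⟩
      sum (λ y → L x y * L† y a - L x y * L† y b)
        ≡⟨ sum-- (λ y → L x y * L† y a) _ ⟩
      M a - M b
        ≡⟨ solve 4 (λ p i q j → p :- q := (p :- i) :- (q :- j) :+ (i :- j)) refl (M a) (I x a) (M b) (I x b) ⟩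
      Z a - Z b + (I x a - I x b)
        ≡⟨ cong (_+ (I x a - I x b)) (trans (cong (_- Z b) (Δ≡0⇒constant Z ΔZ≡0 a b)) (-‿inverseʳ _)) ⟩
      0# + (I x a - I x b)
        ≡⟨ +-identityˡ _ ⟩
      I x a - I x b ∎
      where
      M Z : Fin n → ℝ
      M k = (L · L†) x k
      Z k = M k - I x k
      ΔZ≡0 : ∀ y → Δ Z y ≡ 0#
      ΔZ≡0 y = begin
        Δ Z y
          ≡⟨ sym (L-Δ Z y) ⟩
        sum (λ k → L y k * (M k - I x k))
          ≡⟨ sum-cong-≗ (λ k → trans (cong (_* (M k - I x k)) (L-symmetric y k))
               (solve 3 (λ l m i → l :* (m :- i) := m :* l :- i :* l) refl (L k y) (M k) (I x k))) ⟩
        sum (λ k → M k * L k y - I x k * L k y)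
          ≡⟨ sum-- (λ k → M k * L k y) _ ⟩
        sum (λ k → M k * L k y) - sum (λ k → I x k * L k y)
          ≡⟨ cong₂ _-_ (AA†A≋A x y) (sum-kronecker x (λ k → L k y)) ⟩
        L x y - L x y
          ≡⟨ -‿inverseʳ _ ⟩
        0# ∎

    -- With `v x = L† x i - L† x j`, the voltage of a unit current from `i` to `j`, the right-hand
    -- side is the voltage drop `v i - v j`.
    effectiveResistance-potential : ∀ i j → effectiveResistance L† i j ≡ (L† i i - L† i j) - (L† j i - L† j j)
    effectiveResistance-potential i j = begin
      sum (λ x → sum λ y → e x * (L† x y * e y))
        ≡⟨ sum-cong-≗ (λ x → trans (sym (*-sumˡ (e x) (λ y → L† x y * e y))) (cong (e x *_) (evaluate (L† x)))) ⟩
      sum (λ x → e x * (L† x i - L† x j))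
        ≡⟨ sum-cong-≗ (λ x → *-comm (e x) _) ⟩
      sum (λ x → (L† x i - L† x j) * e x)
        ≡⟨ evaluate (λ x → L† x i - L† x j) ⟩
      (L† i i - L† i j) - (L† j i - L† j j) ∎
      where
      e : Fin n → ℝ
      e x = I i x - I j x
      evaluate : ∀ f → sum (λ y → f y * e y) ≡ f i - f j
      evaluate f = begin
        sum (λ y → f y * (I i y - I j y))
          ≡⟨ sum-cong-≗ (λ y → solve 3 (λ f a b → f :* (a :- b) := a :* f :- b :* f) refl (f y) (I i y) (I j y)) ⟩
        sum (λ y → I i y * f y - I j y * f y)
          ≡⟨ sum-- (λ y → I i y * f y) _ ⟩
        sum (λ y → I i y * f y) - sum (λ y → I j y * f y)
          ≡⟨ cong₂ _-_ (sum-kronecker i f) (sum-kronecker j f) ⟩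
        f i - f j ∎

  path⇒deg-positive : ∀ {x y} → x ≢ y → Star _∼_ x y → 0# < deg x
  path⇒deg-positive x≢x Star.ε = contradiction refl x≢x
  path⇒deg-positive {x} _ (_◅_ {j = z} e _) = <-≤-trans e (term≤sum (w-nonneg x) z)

  -- The vertex of a one-vertex graph has degree 0. Two distinct vertices give every vertex a
  -- nontrivial path, whose first edge has positive weight.
  deg-positive : ∀ {i j} → i ≢ j → ∀ x → 0# < deg x
  deg-positive {i} {j} i≢j x with x Fin.≟ i
  ... | yes refl = path⇒deg-positive i≢j (connected i j)
  ... | no  x≢i  = path⇒deg-positive x≢i (connected x i)

  module _ {x} (0<deg : 0# < deg x) where
    deg*P : ∀ y → deg x * P x y ≡ w x y
    deg*P y = begin
      deg x * (w x y * deg x ⁻¹) ≡⟨ solve 3 (λ d w e → d :* (w :* e) := w :* (d :* e)) refl (deg x) (w x y) (deg x ⁻¹) ⟩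
      w x y * (deg x * deg x ⁻¹) ≡⟨ cong (w x y *_) (*-inverseʳ _ (positive≢0 0<deg)) ⟩
      w x y * 1#                 ≡⟨ *-identityʳ _ ⟩
      w x y                      ∎

    P-nonneg : ∀ y → 0# ≤ P x y
    P-nonneg y = *-nonneg (w-nonneg x y) (⁻¹-nonneg 0<deg)

    sum-P : sum (P x) ≡ 1#
    sum-P = trans (sym (*-sumʳ (deg x ⁻¹) (w x))) (*-inverseʳ _ (positive≢0 0<deg))

    Δ-mean : ∀ u → Δ u x ≡ deg x * (u x - mean u x)
    Δ-mean u = begin
      sum (λ y → w x y * (u x - u y))
        ≡⟨ sum-cong-≗ (λ y → trans (cong (_* (u x - u y)) (sym (deg*P y)))
             (solve 4 (λ d p a b → d :* p :* (a :- b) := d :* (p :* a :- p :* b)) refl (deg x) (P x y) (u x) (u y))) ⟩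
      sum (λ y → deg x * (P x y * u x - P x y * u y))
        ≡⟨ sym (*-sumˡ (deg x) (λ y → P x y * u x - P x y * u y)) ⟩
      deg x * sum (λ y → P x y * u x - P x y * u y)
        ≡⟨ cong (deg x *_) (sum-- (λ y → P x y * u x) _) ⟩
      deg x * (sum (λ y → P x y * u x) - mean u x)
        ≡⟨ cong (λ z → deg x * (z - mean u x)) (trans (sym (*-sumʳ (u x) (P x))) (trans (cong (_* u x) sum-P) (*-identityˡ _))) ⟩
      deg x * (u x - mean u x) ∎

-- The walk killed on {i , j} and its decay.

module KilledWalk {𝓡 : RealNumbers} {n d : ℕ} (G : ConnectionGraph 𝓡 n d) (i j : Fin n) (i≢j : i ≢ j) where
  open RealNumbers 𝓡
  open Matrices 𝓡
  open FieldProperties orderedField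
  open Limits 𝓡
  open ConnectionGraph G
  open Laplacian G

  interior? : ∀ y → Dec (y ≢ i × y ≢ j)
  interior? y = ¬? (y Fin.≟ i) ×-dec ¬? (y Fin.≟ j)

  χ : Fin n → ℝ
  χ y = if does (interior? y) then 1# else 0#

  χ-interior : ∀ {y} → y ≢ i → y ≢ j → χ y ≡ 1#
  χ-interior {y} y≢i y≢j = cong (if_then 1# else 0#) (dec-true (interior? y) (y≢i , y≢j))

  χ-boundary : ∀ {y} → ¬ (y ≢ i × y ≢ j) → χ y ≡ 0#
  χ-boundary {y} p = cong (if_then 1# else 0#) (dec-false (interior? y) p)

  χ-nonneg : ∀ y → 0# ≤ χ y
  χ-nonneg y with does (interior? y)
  ... | true  = 0≤1
  ... | false = ≤-refl

  χ≤1 : ∀ y → χ y ≤ 1#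
  χ≤1 y with does (interior? y)
  ... | true  = ≤-refl
  ... | false = 0≤1

  partition : ∀ y → I i y + I j y + χ y ≡ 1#
  partition y = by-cases (i Fin.≟ y) (j Fin.≟ y)
    where
    by-cases : Dec (i ≡ y) → Dec (j ≡ y) → I i y + I j y + χ y ≡ 1#
    by-cases (yes refl) _ = trans
      (cong₂ _+_ (cong₂ _+_ (kronecker-refl i) (kronecker-≢ (i≢j ∘ sym))) (χ-boundary λ p → proj₁ p refl))
      (solve 0 (con (ℤ.+ 1) :+ con (ℤ.+ 0) :+ con (ℤ.+ 0) := con (ℤ.+ 1)) refl)
    by-cases (no i≢y) (yes refl) = trans
      (cong₂ _+_ (cong₂ _+_ (kronecker-≢ i≢y) (kronecker-refl j)) (χ-boundary λ p → proj₂ p refl))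
      (solve 0 (con (ℤ.+ 0) :+ con (ℤ.+ 1) :+ con (ℤ.+ 0) := con (ℤ.+ 1)) refl)
    by-cases (no i≢y) (no j≢y) = trans
      (cong₂ _+_ (cong₂ _+_ (kronecker-≢ i≢y) (kronecker-≢ j≢y)) (χ-interior (i≢y ∘ sym) (j≢y ∘ sym)))
      (solve 0 (con (ℤ.+ 0) :+ con (ℤ.+ 0) :+ con (ℤ.+ 1) := con (ℤ.+ 1)) refl)

  0<deg : ∀ x → 0# < deg x
  0<deg = deg-positive i≢j

  q : Fin n → Fin n → ℝ
  q x y = χ y * P x y

  Q : (Fin n → ℝ) → Fin n → ℝ
  Q f x = sum λ y → q x y * f y

  q-nonneg : ∀ x y → 0# ≤ q x y
  q-nonneg x y = *-nonneg (χ-nonneg y) (P-nonneg (0<deg x) y)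

  q*-boundary : ∀ x {y} → ¬ (y ≢ i × y ≢ j) → ∀ z → q x y * z ≡ 0#
  q*-boundary x {y} p z = trans (cong (λ c → c * P x y * z) (χ-boundary p))
    (solve 2 (λ p z → con (ℤ.+ 0) :* p :* z := con (ℤ.+ 0)) refl (P x y) z)

  sum-q≤1 : ∀ x → sum (q x) ≤ 1#
  sum-q≤1 x = subst (sum (q x) ≤_) (sum-P (0<deg x)) (sum-mono λ y →
    subst (q x y ≤_) (*-identityˡ _) (*-monoʳ-≤ (P-nonneg (0<deg x) y) (χ≤1 y)))

  Q-mono : ∀ {f g} → (∀ y → f y ≤ g y) → ∀ x → Q f x ≤ Q g x
  Q-mono f≤g x = sum-mono λ y → *-monoˡ-≤ (q-nonneg x y) (f≤g y)

  Q-+ : ∀ f g x → Q (λ y → f y + g y) x ≡ Q f x + Q g x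
  Q-+ f g x = trans (sum-cong-≗ λ y → distribˡ (q x y) (f y) (g y)) (∑-distrib-+ (λ y → q x y * f y) _)

  Q-* : ∀ c f x → Q (λ y → c * f y) x ≡ c * Q f x
  Q-* c f x = trans
    (sum-cong-≗ λ y → solve 3 (λ q c f → q :* (c :* f) := c :* (q :* f)) refl (q x y) c (f y))
    (sym (*-sumˡ c (λ y → q x y * f y)))

  Q-jensen : ∀ a x → Q a x * Q a x ≤ Q (λ y → a y * a y) x
  Q-jensen a x = jensen a (q-nonneg x) (sum-q≤1 x)

  Q-const≤ : ∀ {c} → 0# ≤ c → ∀ x → Q (λ _ → c) x ≤ c
  Q-const≤ {c} 0≤c x = subst₂ _≤_ (*-sumʳ c (q x)) (*-identityˡ c) (*-monoʳ-≤ 0≤c (sum-q≤1 x))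

  -- A strict supersolution bounds the total mass of the iterates of Q.
  module Decay (g : Fin n → ℝ) (g-nonneg : ∀ x → 0# ≤ g x)
               (g-super : ∀ x → 1# ≤ deg x * (g x - Q g x)) where

    -- `s t` is the constant `Φ` after `t` applications of `Q`. It dominates `φ t` and decreases in
    -- `t`, so `t` times it is at most the sum `A t` of its predecessors. That sum obeys
    -- `A (t + 1) = Φ + Q (A t)` and never exceeds `κ * g`, because `Φ + Q (κ * g) ≤ κ * g`.
    decay : (φ : ℕ → Fin n → ℝ) → (∀ t x → 0# ≤ φ t x) → (∀ t x → φ (suc t) x ≤ Q (φ t) x) →
            ∀ x → (λ t → φ t x) ⟶ 0#
    decay φ φ-nonneg φ-sub x = fromℕ*-bounded⇒0⟵ (λ t → φ-nonneg t x) λ t → ≤-trans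
        (*-monoˡ-≤ (fromℕ-nonneg t) (φ≤s t x)) (≤-trans (t*s≤A t x) (A≤κg t x))
      where
      Φ κ : ℝ
      Φ = sum (φ 0)
      -- The gap `g x - Q g x` is only known to be at least `1 / deg x`; the factor `sum deg` makes
      -- the bound uniform in `x`.
      κ = Φ * sum deg
      s A : ℕ → Fin n → ℝ
      s zero    = λ _ → Φ
      s (suc t) = Q (s t)
      A zero    = λ _ → 0#
      A (suc t) = λ x → s t x + A t x
      Φ-nonneg : 0# ≤ Φ
      Φ-nonneg = sum-nonneg (φ-nonneg 0)
      φ≤s : ∀ t x → φ t x ≤ s t x
      φ≤s zero    = term≤sum (φ-nonneg 0)
      φ≤s (suc t) x = ≤-trans (φ-sub t x) (Q-mono (φ≤s t) x)
      s-decreasing : ∀ t x → s (suc t) x ≤ s t x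
      s-decreasing zero    = Q-const≤ Φ-nonneg
      s-decreasing (suc t) = Q-mono (s-decreasing t)
      t*s≤A : ∀ t x → fromℕ t * s t x ≤ A t x
      t*s≤A zero    x = ≤-reflexive (zeroˡ _)
      t*s≤A (suc t) x = begin
        (1# + fromℕ t) * s (suc t) x   ≤⟨ *-monoˡ-≤ (fromℕ-nonneg (suc t)) (s-decreasing t x) ⟩
        (1# + fromℕ t) * s t x         ≡⟨ solve 2 (λ k s → (con (ℤ.+ 1) :+ k) :* s := s :+ k :* s) refl (fromℕ t) (s t x) ⟩
        s t x + fromℕ t * s t x        ≤⟨ +-monoʳ-≤ (s t x) (t*s≤A t x) ⟩
        s t x + A t x                  ∎
        where open ≤-Reasoning
      A-recursion : ∀ t x → A (suc t) x ≡ Φ + Q (A t) x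
      A-recursion zero    x = cong (Φ +_) (sym (sum-zero λ y → zeroʳ (q x y)))
      A-recursion (suc t) x = begin
        Q (s t) x + (s t x + A t x)       ≡⟨ cong (Q (s t) x +_) (A-recursion t x) ⟩
        Q (s t) x + (Φ + Q (A t) x)       ≡⟨ solve 3 (λ a b c → a :+ (b :+ c) := b :+ (a :+ c)) refl (Q (s t) x) Φ (Q (A t) x) ⟩
        Φ + (Q (s t) x + Q (A t) x)       ≡⟨ cong (Φ +_) (sym (Q-+ (s t) (A t) x)) ⟩
        Φ + Q (λ y → s t y + A t y) x     ∎
        where open ≡-Reasoning
      κ-nonneg : 0# ≤ κ
      κ-nonneg = *-nonneg Φ-nonneg (sum-nonneg (proj₁ ∘ 0<deg))
      Φ≤κ : ∀ x → Φ ≤ κ * (g x - Q g x)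
      Φ≤κ x = begin
        Φ                               ≡⟨ sym (*-identityʳ Φ) ⟩
        Φ * 1#                          ≤⟨ *-monoˡ-≤ Φ-nonneg (≤-trans (g-super x) (*-monoʳ-≤ gap-nonneg (term≤sum (proj₁ ∘ 0<deg) x))) ⟩
        Φ * (sum deg * (g x - Q g x))   ≡⟨ sym (*-assoc _ _ _) ⟩
        κ * (g x - Q g x)               ∎
        where
        open ≤-Reasoning
        gap-nonneg : 0# ≤ g x - Q g x
        gap-nonneg = *-cancelˡ-≤ (0<deg x) (subst (_≤ deg x * (g x - Q g x)) (sym (zeroʳ _)) (≤-trans 0≤1 (g-super x)))
      A≤κg : ∀ t x → A t x ≤ κ * g x
      A≤κg zero    x = *-nonneg κ-nonneg (g-nonneg x)
      A≤κg (suc t) x = begin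
        A (suc t) x                             ≡⟨ A-recursion t x ⟩
        Φ + Q (A t) x                           ≤⟨ +-mono-≤ (Φ≤κ x) (Q-mono (A≤κg t) x) ⟩
        κ * (g x - Q g x) + Q (λ y → κ * g y) x ≡⟨ cong (κ * (g x - Q g x) +_) (Q-* κ g x) ⟩
        κ * (g x - Q g x) + κ * Q g x           ≡⟨ solve 3 (λ k g h → k :* (g :- h) :+ k :* h := k :* g) refl κ (g x) (Q g x) ⟩
        κ * g x                                 ∎
        where open ≤-Reasoning

    -- Squaring trades a signed solution for a nonnegative subsolution: the rows of `q` have mass at
    -- most 1, so the square of `Q R` is at most `Q` of the square of `R`.
    decay-signed : (R : ℕ → Fin n → ℝ) → (∀ t x → R (suc t) x ≡ Q (R t) x) → ∀ x → (λ t → R t x) ⟶ 0#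
    decay-signed R step x = square≤⇒0⟵ (λ _ → ≤-refl)
      (decay (λ t x → R t x * R t x) (λ t x → square-nonneg (R t x))
        (λ t x → subst (λ r → r * r ≤ Q (λ y → R t y * R t y) x) (sym (step t x)) (Q-jensen (R t) x)) x)

    transported : (Fin n → Fin d → ℝ) → Fin n → Fin d → ℝ
    transported H x r = Q (λ y → sum λ k → σ x y r k * H y k) x

    norm² : (Fin d → ℝ) → ℝ
    norm² v = sum λ r → v r * v r

    orthogonal-norm² : ∀ {A : Matrix d d} → A ᵀ · A ≋ I → ∀ v → norm² (λ r → sum λ k → A r k * v k) ≡ norm² v
    orthogonal-norm² {A} AᵀA≋I v = begin
      sum (λ r → Av r * Av r)
        ≡⟨ sum-cong-≗ (λ r → trans (*-sumʳ (Av r) (λ k → A r k * v k))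
             (sum-cong-≗ λ k → solve 3 (λ a v z → a :* v :* z := v :* (a :* z)) refl (A r k) (v k) (Av r))) ⟩
      sum (λ r → sum λ k → v k * (A r k * Av r))
        ≡⟨ ∑-comm {d} {d} (λ r k → v k * (A r k * Av r)) ⟩
      sum (λ k → sum λ r → v k * (A r k * Av r))
        ≡⟨ sum-cong-≗ (λ k → trans (sym (*-sumˡ (v k) (λ r → A r k * Av r))) (cong (v k *_) (AᵀAv k))) ⟩
      sum (λ k → v k * v k) ∎
      where
      open ≡-Reasoning
      Av : Fin d → ℝ
      Av r = sum λ k → A r k * v k
      AᵀAv : ∀ k → sum (λ r → A r k * Av r) ≡ v k
      AᵀAv k = begin
        sum (λ r → A r k * sum λ l → A r l * v l)
          ≡⟨ sum-cong-≗ (λ r → trans (*-sumˡ (A r k) (λ l → A r l * v l)) (sum-cong-≗ λ l → sym (*-assoc (A r k) (A r l) (v l)))) ⟩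
        sum (λ r → sum λ l → A r k * A r l * v l)
          ≡⟨ ∑-comm {d} {d} (λ r l → A r k * A r l * v l) ⟩
        sum (λ l → sum λ r → A r k * A r l * v l)
          ≡⟨ sum-cong-≗ (λ l → trans (sym (*-sumʳ (v l) (λ r → A r k * A r l))) (cong (_* v l) (AᵀA≋I k l))) ⟩
        sum (λ l → I k l * v l)
          ≡⟨ sum-kronecker k v ⟩
        v k ∎

    -- `Q-jensen` is applied to each coordinate of the transported vector; summing over the
    -- coordinates produces the squared norms of `σ x y` applied to `H t y`, from which `σ`
    -- disappears.
    decay-transported : (H : ℕ → Fin n → Fin d → ℝ) → (∀ t x r → H (suc t) x r ≡ transported (H t) x r) →
                        ∀ x r → (λ t → H t x r) ⟶ 0#
    decay-transported H step x r = square≤⇒0⟵ (λ t → term≤sum (λ r → square-nonneg (H t x r)) r)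
      (decay (λ t x → norm² (H t x)) (λ t x → sum-nonneg λ r → square-nonneg (H t x r)) norm²-sub x)
      where
      σH : ℕ → Fin n → Fin d → Fin n → ℝ
      σH t x r y = sum λ k → σ x y r k * H t y k
      -- `σ` is constrained on edges alone, so the identity carries the factor `q x y`, which is 0
      -- off the edges.
      isometry : ∀ t x y → q x y * norm² (λ r → σH t x r y) ≡ q x y * norm² (H t y)
      isometry t x y with 0# ≟ℝ w x y
      ... | no  0≢w = cong (q x y *_) (orthogonal-norm² (proj₁ (σ-orthogonal (w-nonneg x y , 0≢w))) (H t y))
      ... | yes 0≡w = trans (cong (_* norm² (λ r → σH t x r y)) q≡0) (trans (zeroˡ _)
                        (sym (trans (cong (_* norm² (H t y)) q≡0) (zeroˡ _))))
        where
        q≡0 : q x y ≡ 0#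
        q≡0 = trans (cong (λ w → χ y * (w * deg x ⁻¹)) (sym 0≡w)) (trans (cong (χ y *_) (zeroˡ _)) (zeroʳ _))
      norm²-sub : ∀ t x → norm² (H (suc t) x) ≤ Q (λ y → norm² (H t y)) x
      norm²-sub t x = begin
        sum (λ r → H (suc t) x r * H (suc t) x r)
          ≡⟨ sum-cong-≗ (λ r → cong (λ h → h * h) (step t x r)) ⟩
        sum (λ r → Q (σH t x r) x * Q (σH t x r) x)
          ≤⟨ sum-mono (λ r → Q-jensen (σH t x r) x) ⟩
        sum (λ r → sum λ y → q x y * (σH t x r y * σH t x r y))
          ≡⟨ ∑-comm {d} {n} (λ r y → q x y * (σH t x r y * σH t x r y)) ⟩
        sum (λ y → sum λ r → q x y * (σH t x r y * σH t x r y))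
          ≡⟨ sum-cong-≗ (λ y → trans (sym (*-sumˡ (q x y) (λ r → σH t x r y * σH t x r y))) (isometry t x y)) ⟩
        Q (λ y → norm² (H t y)) x ∎
        where open ≤-Reasoning

-- Supersolution, optional stopping and effective conductance.

module Stopping {𝓡 : RealNumbers} {n d : ℕ} (G : ConnectionGraph 𝓡 n d) (i j : Fin n) (i≢j : i ≢ j)
                {L† : Matrices.Matrix 𝓡 n n}
                (penrose : Matrices.IsMoorePenroseInverse 𝓡 (ConnectionGraph.L G) L†) where
  open RealNumbers 𝓡
  open Matrices 𝓡
  open FieldProperties orderedField
  open Limits 𝓡
  open ConnectionGraph G
  open Laplacian G
  open KilledWalk G i j i≢j

  -- u is the sum over y of the potentials of y against i, shifted to be nonnegative.
  potential : ∃[ u ] (∀ x → 0# ≤ u x) × (∀ x → x ≢ i → Δ u x ≡ 1#)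
  potential = u , (λ x → x≤y⇒0≤y-x (proj₂ maximum x)) , Δu≡1
    where
    v u : Fin n → ℝ
    v x = sum λ y → L† x i - L† x y
    maximum = argmax v i
    u x = v (proj₁ maximum) - v x
    Δv≡-1 : ∀ x → x ≢ i → Δ v x ≡ - 1#
    Δv≡-1 x x≢i = begin
      Δ v x
        ≡⟨ Δ-sum (λ y z → L† z i - L† z y) x ⟩
      sum (λ y → Δ (λ z → L† z i - L† z y) x)
        ≡⟨ sum-cong-≗ (λ y → trans (Δ-potential penrose i y x) (cong (_- I x y) (kronecker-≢ x≢i))) ⟩
      sum (λ y → 0# - I x y)
        ≡⟨ sum-cong-≗ (λ y → solve 1 (λ a → con (ℤ.+ 0) :- a := :- (a :* con (ℤ.+ 1))) refl (I x y)) ⟩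
      sum (λ y → - (I x y * 1#))
        ≡⟨ sum-neg (λ y → I x y * 1#) ⟩
      - sum (λ y → I x y * 1#)
        ≡⟨ cong -_ (sum-kronecker x (λ _ → 1#)) ⟩
      - 1# ∎
      where open ≡-Reasoning
    Δu≡1 : ∀ x → x ≢ i → Δ u x ≡ 1#
    Δu≡1 x x≢i = trans (Δ-affine (v (proj₁ maximum)) v x) (trans (cong -_ (Δv≡-1 x x≢i))
      (solve 0 (:- :- con (ℤ.+ 1) := con (ℤ.+ 1)) refl))

  u₀ g : Fin n → ℝ
  u₀ = proj₁ potential
  g x = deg x ⁻¹ + Q u₀ x

  g-nonneg : ∀ x → 0# ≤ g x
  g-nonneg x = +-nonneg (⁻¹-nonneg (0<deg x))
    (sum-nonneg λ y → *-nonneg (q-nonneg x y) (proj₁ (proj₂ potential) y))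

  -- Off `i`, the equation `Δ u₀ = 1` reads `u₀ = 1 / deg + mean u₀`, and `Q` only drops nonnegative
  -- terms of the mean.
  g≤u₀ : ∀ y → y ≢ i → g y ≤ u₀ y
  g≤u₀ y y≢i = *-cancelˡ-≤ (0<deg y) (begin
    deg y * (deg y ⁻¹ + Q u₀ y)    ≤⟨ *-monoˡ-≤ (proj₁ (0<deg y)) (+-monoʳ-≤ (deg y ⁻¹) Qu₀≤mean) ⟩
    deg y * (deg y ⁻¹ + mean u₀ y) ≡⟨ distribˡ (deg y) _ _ ⟩
    deg y * deg y ⁻¹ + deg y * mean u₀ y
                                   ≡⟨ cong (_+ deg y * mean u₀ y) (trans (*-inverseʳ _ (positive≢0 (0<deg y)))
                                        (sym (trans (sym (Δ-mean (0<deg y) u₀)) (proj₂ (proj₂ potential) y y≢i)))) ⟩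
    deg y * (u₀ y - mean u₀ y) + deg y * mean u₀ y
                                   ≡⟨ solve 3 (λ d u m → d :* (u :- m) :+ d :* m := d :* u) refl (deg y) (u₀ y) (mean u₀ y) ⟩
    deg y * u₀ y                   ∎)
    where
    open ≤-Reasoning
    Qu₀≤mean : Q u₀ y ≤ mean u₀ y
    Qu₀≤mean = sum-mono λ z → *-monoʳ-≤ (proj₁ (proj₂ potential) z)
      (subst (q y z ≤_) (*-identityˡ _) (*-monoʳ-≤ (P-nonneg (0<deg y) z) (χ≤1 z)))

  g-super : ∀ x → 1# ≤ deg x * (g x - Q g x)
  g-super x = begin
    1#                                          ≡⟨ sym (*-inverseʳ _ (positive≢0 (0<deg x))) ⟩
    deg x * deg x ⁻¹                            ≤⟨ *-monoˡ-≤ (proj₁ (0<deg x)) (begin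
      deg x ⁻¹                         ≤⟨ x≤x+nonneg (x≤y⇒0≤y-x Qg≤Qu₀) ⟩
      deg x ⁻¹ + (Q u₀ x - Q g x)      ≡⟨ sym (+-assoc _ _ _) ⟩
      g x - Q g x                      ∎) ⟩
    deg x * (g x - Q g x)                       ∎
    where
    open ≤-Reasoning
    Qg≤Qu₀ : Q g x ≤ Q u₀ x
    Qg≤Qu₀ = sum-mono λ y → on-interior y (y Fin.≟ i)
      where
      on-interior : ∀ y → Dec (y ≡ i) → q x y * g y ≤ q x y * u₀ y
      on-interior y (no  y≢i) = *-monoˡ-≤ (q-nonneg x y) (g≤u₀ y y≢i)
      on-interior y (yes y≡i) = ≤-reflexive (trans (q*-boundary x y∉ (g y)) (sym (q*-boundary x y∉ (u₀ y))))
        where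
        y∉ : ¬ (y ≢ i × y ≢ j)
        y∉ p = proj₁ p y≡i

  open Decay g g-nonneg g-super public

  mean-split : ∀ u x → mean u x ≡ P x i * u i + P x j * u j + Q u x
  mean-split u x = begin
    sum (λ y → P x y * u y)
      ≡⟨ sum-cong-≗ (λ y → trans (sym (*-identityˡ _)) (trans (cong (_* (P x y * u y)) (sym (partition y)))
           (solve 5 (λ a b c p u → (a :+ b :+ c) :* (p :* u) := (a :* (p :* u) :+ b :* (p :* u)) :+ c :* p :* u)
             refl (I i y) (I j y) (χ y) (P x y) (u y)))) ⟩
    sum (λ y → (I i y * (P x y * u y) + I j y * (P x y * u y)) + q x y * u y)
      ≡⟨ ∑-distrib-+ (λ y → I i y * (P x y * u y) + I j y * (P x y * u y)) _ ⟩
    sum (λ y → I i y * (P x y * u y) + I j y * (P x y * u y)) + Q u x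
      ≡⟨ cong (_+ Q u x) (trans (∑-distrib-+ (λ y → I i y * (P x y * u y)) _)
           (cong₂ _+_ (sum-kronecker i (λ y → P x y * u y)) (sum-kronecker j (λ y → P x y * u y)))) ⟩
    P x i * u i + P x j * u j + Q u x ∎
    where open ≡-Reasoning

  -- Keeps measure theory out of the analysis: the walk enters through these two recursions. Index
  -- `t` stands for hitting time `t + 1`.
  record HittingTimes (b : Fin n) (h : ℕ → Fin n → ℝ) : Set where
    field
      one-step : ∀ x → h 0 x ≡ P x b
      recursion : ∀ t x → h (suc t) x ≡ Q (h t) x

    cumulative : ℕ → Fin n → ℝ
    cumulative M x = partialSums (λ t → h t x) M

    cumulative-suc : ∀ M x → cumulative (suc M) x ≡ P x b + Q (cumulative M) x
    cumulative-suc M x = cong₂ _+_ (one-step x) (begin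
      sum {M} (λ t → h (suc (toℕ t)) x)
        ≡⟨ sum-cong-≗ {M} (λ t → recursion (toℕ t) x) ⟩
      sum {M} (λ t → sum λ y → q x y * h (toℕ t) y)
        ≡⟨ ∑-comm {M} {n} (λ t y → q x y * h (toℕ t) y) ⟩
      sum (λ y → sum {M} λ t → q x y * h (toℕ t) y)
        ≡⟨ sum-cong-≗ (λ y → sym (*-sumˡ {M} (q x y) (λ t → h (toℕ t) y))) ⟩
      Q (cumulative M) x ∎)
      where open ≡-Reasoning

  module _ {hᵢ hⱼ : ℕ → Fin n → ℝ} (hitᵢ : HittingTimes i hᵢ) (hitⱼ : HittingTimes j hⱼ) where
    open HittingTimes

    -- The left side is `mean u x` and not `u x` because stopping starts at time 1. The identity
    -- then holds at `i` and `j` too, where `u` need not be harmonic.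
    optional-stopping : ∀ u → (∀ x → x ≢ i → x ≢ j → Δ u x ≡ 0#) → ∀ x {pᵢ pⱼ} →
                        HasSum (λ t → hᵢ t x) pᵢ → HasSum (λ t → hⱼ t x) pⱼ →
                        mean u x ≡ u i * pᵢ + u j * pⱼ
    optional-stopping u harmonic x {pᵢ} {pⱼ} sumᵢ sumⱼ = ⟶-unique (⟶-const (mean u x))
      (subst ((λ _ → mean u x) ⟶_) (+-identityʳ _)
        (⟶-cong (λ M → sym (stopped M x))
          (⟶-+ (⟶-+ (⟶-* (u i) sumᵢ) (⟶-* (u j) sumⱼ)) (decay-signed R (λ _ _ → refl) x))))
      where
      -- `R M` is the part of the mean still carried by walks that survived `M` steps; it is
      -- expanded step by step, using `u = mean u` at interior vertices.
      R : ℕ → Fin n → ℝ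
      R zero    = mean u
      R (suc M) = Q (R M)
      Qu≡Qmean : ∀ x → Q u x ≡ Q (mean u) x
      Qu≡Qmean x = sum-cong-≗ λ y → on-interior y (interior? y)
        where
        on-interior : ∀ y → Dec (y ≢ i × y ≢ j) → q x y * u y ≡ q x y * mean u y
        on-interior y (yes (y≢i , y≢j)) = cong (q x y *_) (x-y≡0⇒x≡y _ _
          (x*y≡0⇒y≡0 (positive≢0 (0<deg y)) (trans (sym (Δ-mean (0<deg y) u)) (harmonic y y≢i y≢j))))
        on-interior y (no  p) = trans (q*-boundary x p (u y)) (sym (q*-boundary x p (mean u y)))
      Gᵢ Gⱼ : ℕ → Fin n → ℝ
      Gᵢ = cumulative hitᵢ
      Gⱼ = cumulative hitⱼ
      stopped : ∀ M x → mean u x ≡ u i * Gᵢ M x + u j * Gⱼ M x + R M x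
      stopped zero    x = solve 3 (λ a b m → m := a :* con (ℤ.+ 0) :+ b :* con (ℤ.+ 0) :+ m) refl (u i) (u j) (mean u x)
      stopped (suc M) x = begin
        mean u x
          ≡⟨ mean-split u x ⟩
        P x i * u i + P x j * u j + Q u x
          ≡⟨ cong (P x i * u i + P x j * u j +_) (trans (Qu≡Qmean x) (sum-cong-≗ λ y → cong (q x y *_) (stopped M y))) ⟩
        P x i * u i + P x j * u j + Q (λ y → u i * Gᵢ M y + u j * Gⱼ M y + R M y) x
          ≡⟨ cong (P x i * u i + P x j * u j +_) (trans (Q-+ (λ y → u i * Gᵢ M y + u j * Gⱼ M y) (R M) x)
               (cong (_+ Q (R M) x) (trans (Q-+ (λ y → u i * Gᵢ M y) (λ y → u j * Gⱼ M y) x)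
                 (cong₂ _+_ (Q-* (u i) (Gᵢ M) x) (Q-* (u j) (Gⱼ M) x))))) ⟩
        P x i * u i + P x j * u j + (u i * Q (Gᵢ M) x + u j * Q (Gⱼ M) x + Q (R M) x)
          ≡⟨ solve 7 (λ a b p r v z w → p :* a :+ r :* b :+ (a :* v :+ b :* z :+ w) :=
               a :* (p :+ v) :+ b :* (r :+ z) :+ w) refl (u i) (u j) (P x i) (P x j) (Q (Gᵢ M) x) (Q (Gⱼ M) x) (Q (R M) x) ⟩
        u i * (P x i + Q (Gᵢ M) x) + u j * (P x j + Q (Gⱼ M) x) + Q (R M) x
          ≡⟨ cong (_+ Q (R M) x) (cong₂ _+_ (cong (u i *_) (sym (cumulative-suc hitᵢ M x)))
                                            (cong (u j *_) (sym (cumulative-suc hitⱼ M x)))) ⟩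
        u i * Gᵢ (suc M) x + u j * Gⱼ (suc M) x + Q (R M) x ∎
        where open ≡-Reasoning

    hitting-total : ∀ x {pᵢ pⱼ} → HasSum (λ t → hᵢ t x) pᵢ → HasSum (λ t → hⱼ t x) pⱼ → pᵢ + pⱼ ≡ 1#
    hitting-total x {pᵢ} {pⱼ} sumᵢ sumⱼ = begin
      pᵢ + pⱼ             ≡⟨ sym (cong₂ _+_ (*-identityˡ pᵢ) (*-identityˡ pⱼ)) ⟩
      1# * pᵢ + 1# * pⱼ   ≡⟨ sym (optional-stopping (λ _ → 1#) (λ y _ _ → Δ1≡0 y) x sumᵢ sumⱼ) ⟩
      mean (λ _ → 1#) x   ≡⟨ trans (sum-cong-≗ λ y → *-identityʳ (P x y)) (sum-P (0<deg x)) ⟩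
      1#                  ∎
      where
      open ≡-Reasoning
      Δ1≡0 : ∀ y → Δ (λ _ → 1#) y ≡ 0#
      Δ1≡0 y = sum-zero λ z → trans (cong (w y z *_) (-‿inverseʳ 1#)) (zeroʳ _)

    private
      v : Fin n → ℝ
      v x = L† x i - L† x j

    potential-drop : ∀ x {pᵢ pⱼ} → HasSum (λ t → hᵢ t x) pᵢ → HasSum (λ t → hⱼ t x) pⱼ →
                     deg x * (v x - (v i * pᵢ + v j * pⱼ)) ≡ I x i - I x j
    potential-drop x {pᵢ} {pⱼ} sumᵢ sumⱼ = begin
      deg x * (v x - (v i * pᵢ + v j * pⱼ))
        ≡⟨ cong (λ m → deg x * (v x - m)) (sym (optional-stopping v harmonic x sumᵢ sumⱼ)) ⟩
      deg x * (v x - mean v x)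
        ≡⟨ sym (Δ-mean (0<deg x) v) ⟩
      Δ v x
        ≡⟨ Δ-potential penrose i j x ⟩
      I x i - I x j ∎
      where
      open ≡-Reasoning
      harmonic : ∀ x → x ≢ i → x ≢ j → Δ v x ≡ 0#
      harmonic x x≢i x≢j = trans (Δ-potential penrose i j x)
        (trans (cong₂ _-_ (kronecker-≢ x≢i) (kronecker-≢ x≢j)) (-‿inverseʳ 0#))

    -- Since `pᵢ = 1 - pⱼ`, the drop `v i - (v i * pᵢ + v j * pⱼ)` is `(v i - v j) * pⱼ`, resistance
    -- times escape probability. A product equal to 1 also shows that the resistance is nonzero, so
    -- that `⁻¹` is its true inverse.
    effectiveConductance-i : ∀ {pᵢ pⱼ} → HasSum (λ t → hᵢ t i) pᵢ → HasSum (λ t → hⱼ t i) pⱼ →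
                             effectiveConductance L† i j ≡ deg i * pⱼ
    effectiveConductance-i {pᵢ} {pⱼ} sumᵢ sumⱼ = ⁻¹-unique (begin
      effectiveResistance L† i j * (deg i * pⱼ)
        ≡⟨ cong (_* (deg i * pⱼ)) (effectiveResistance-potential penrose i j) ⟩
      (v i - v j) * (deg i * pⱼ)
        ≡⟨ solve 4 (λ a b d p → (a :- b) :* (d :* p) := d :* (a :* con (ℤ.+ 1) :- (a :* (con (ℤ.+ 1) :- p) :+ b :* p))) refl (v i) (v j) (deg i) pⱼ ⟩
      deg i * (v i * 1# - (v i * (1# - pⱼ) + v j * pⱼ))
        ≡⟨ cong₂ (λ a p → deg i * (a - (v i * p + v j * pⱼ))) (*-identityʳ (v i))
             (trans (cong (_- pⱼ) (sym (hitting-total i sumᵢ sumⱼ))) (solve 2 (λ a b → (a :+ b) :- b := a) refl pᵢ pⱼ)) ⟩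
      deg i * (v i - (v i * pᵢ + v j * pⱼ))
        ≡⟨ potential-drop i sumᵢ sumⱼ ⟩
      I i i - I i j
        ≡⟨ cong₂ _-_ (kronecker-refl i) (kronecker-≢ i≢j) ⟩
      1# - 0#
        ≡⟨ solve 0 (con (ℤ.+ 1) :- con (ℤ.+ 0) := con (ℤ.+ 1)) refl ⟩
      1# ∎)
      where open ≡-Reasoning

    -- At `j` the unit current leaves the network, which accounts for the sign.
    effectiveConductance-j : ∀ {pᵢ pⱼ} → HasSum (λ t → hᵢ t j) pᵢ → HasSum (λ t → hⱼ t j) pⱼ →
                             effectiveConductance L† i j ≡ deg j * pᵢ
    effectiveConductance-j {pᵢ} {pⱼ} sumᵢ sumⱼ = ⁻¹-unique (begin
      effectiveResistance L† i j * (deg j * pᵢ)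
        ≡⟨ cong (_* (deg j * pᵢ)) (effectiveResistance-potential penrose i j) ⟩
      (v i - v j) * (deg j * pᵢ)
        ≡⟨ solve 4 (λ a b d p → (a :- b) :* (d :* p) := :- (d :* (b :* con (ℤ.+ 1) :- (a :* p :+ b :* (con (ℤ.+ 1) :- p))))) refl (v i) (v j) (deg j) pᵢ ⟩
      - (deg j * (v j * 1# - (v i * pᵢ + v j * (1# - pᵢ))))
        ≡⟨ cong₂ (λ a p → - (deg j * (a - (v i * pᵢ + v j * p)))) (*-identityʳ (v j))
             (trans (cong (_- pᵢ) (sym (hitting-total j sumᵢ sumⱼ))) (solve 2 (λ a b → (a :+ b) :- a := b) refl pᵢ pⱼ)) ⟩
      - (deg j * (v j - (v i * pᵢ + v j * pⱼ)))
        ≡⟨ cong -_ (potential-drop j sumᵢ sumⱼ) ⟩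
      - (I j i - I j j)
        ≡⟨ cong -_ (cong₂ _-_ (kronecker-≢ (i≢j ∘ sym)) (kronecker-refl j)) ⟩
      - (0# - 1#)
        ≡⟨ solve 0 (:- (con (ℤ.+ 0) :- con (ℤ.+ 1)) := con (ℤ.+ 1)) refl ⟩
      1# ∎)
      where open ≡-Reasoning

-- Reindexing of sums over blocks and lists, and matrices as operators.

lookup-injective : ∀ {A : Set} {xs : List A} → Unique xs → ∀ s t → List.lookup xs s ≡ List.lookup xs t → s ≡ t
lookup-injective (_ ∷ _)    zero    zero    _  = refl
lookup-injective (x∉xs ∷ _) zero    (suc t) eq = contradiction eq (All.lookup x∉xs (∈-lookup t))
lookup-injective (x∉xs ∷ _) (suc s) zero    eq = contradiction (sym eq) (All.lookup x∉xs (∈-lookup s))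
lookup-injective (_ ∷ xs!)  (suc s) (suc t) eq = cong suc (lookup-injective xs! s t eq)

module SumReindexing (𝓕 : OrderedField) where
  open OrderedField 𝓕
  open FieldProperties 𝓕

  sum-↑ : ∀ m {n} (f : Fin (m ℕ.+ n) → ℝ) → sum f ≡ sum (λ i → f (i ↑ˡ n)) + sum (λ i → f (m ↑ʳ i))
  sum-↑ zero    f = sym (+-identityˡ _)
  sum-↑ (suc m) f = trans (cong (f zero +_) (sum-↑ m (f ∘ suc))) (sym (+-assoc _ _ _))

  sum-combine : ∀ m d (f : Fin (m ℕ.* d) → ℝ) → sum f ≡ sum λ x → sum λ r → f (combine {m} x r)
  sum-combine zero    d f = refl
  sum-combine (suc m) d f = trans (sum-↑ d f) (cong (sum (λ r → f (r ↑ˡ (m ℕ.* d))) +_) (sum-combine m d (λ p → f (d ↑ʳ p))))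

  sum-remQuot : ∀ m d (f : Fin m → Fin d → ℝ) →
                sum {m ℕ.* d} (λ p → f (proj₁ (remQuot {m} d p)) (proj₂ (remQuot {m} d p))) ≡ sum λ x → sum (f x)
  sum-remQuot m d f = trans (sum-combine m d _) (sum-cong-≗ λ x → sum-cong-≗ λ r →
    cong (λ xr → f (proj₁ xr) (proj₂ xr)) (Fin.remQuot-combine {m} x r))

  sum-tabulate : ∀ {A : Set} {n} (g : Fin n → A) (f : A → ℝ) → sum (λ s → f (List.lookup (tabulate g) s)) ≡ sum (λ x → f (g x))
  sum-tabulate {n = zero}  g f = refl
  sum-tabulate {n = suc n} g f = cong (f (g zero) +_) (sum-tabulate (g ∘ suc) f)

  sum-filter : ∀ {A : Set} {p : Pred A 0ℓ} (p? : Decidable p) (f : A → ℝ) (xs : List A) →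
               sum (λ s → f (List.lookup (filter p? xs) s)) ≡
               sum (λ s → (if does (p? (List.lookup xs s)) then 1# else 0#) * f (List.lookup xs s))
  sum-filter p? f []       = refl
  sum-filter p? f (x ∷ xs) with does (p? x)
  ... | true  = cong₂ _+_ (sym (*-identityˡ _)) (sum-filter p? f xs)
  ... | false = trans (sum-filter p? f xs) (sym (trans (cong (_+ sum rest) (zeroˡ _)) (+-identityˡ _)))
    where
    rest : Fin (length xs) → ℝ
    rest s = (if does (p? (List.lookup xs s)) then 1# else 0#) * f (List.lookup xs s)

module MatrixAction (𝓡 : RealNumbers) where
  open RealNumbers 𝓡
  open Matrices 𝓡
  open FieldProperties orderedField

  apply : ∀ {m n} → Matrix m n → (Fin n → ℝ) → Fin m → ℝ
  apply A v r = sum λ k → A r k * v k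

  apply-· : ∀ {l m n} (A : Matrix l m) (B : Matrix m n) v r → apply (A · B) v r ≡ apply A (apply B v) r
  apply-· {l} {m} {n} A B v r = begin
    sum (λ k → sum (λ s → A r s * B s k) * v k)
      ≡⟨ sum-cong-≗ (λ k → *-sumʳ (v k) (λ s → A r s * B s k)) ⟩
    sum (λ k → sum λ s → A r s * B s k * v k)
      ≡⟨ ∑-comm {n} {m} (λ k s → A r s * B s k * v k) ⟩
    sum (λ s → sum λ k → A r s * B s k * v k)
      ≡⟨ sum-cong-≗ (λ s → trans (sum-cong-≗ λ k → *-assoc (A r s) (B s k) (v k)) (sym (*-sumˡ (A r s) (λ k → B s k * v k)))) ⟩
    apply A (apply B v) r ∎
    where open ≡-Reasoning

  apply-- : ∀ {m n} (A : Matrix m n) u v r → apply A (λ k → u k - v k) r ≡ apply A u r - apply A v r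
  apply-- A u v r = trans
    (sum-cong-≗ λ k → solve 3 (λ a u v → a :* (u :- v) := a :* u :- a :* v) refl (A r k) (u k) (v k))
    (sum-- (λ k → A r k * u k) _)

-- The interior block of the connection Laplacian and its Schur complement.

module SchurComplement {𝓡 : RealNumbers} {n d : ℕ} (G : ConnectionGraph 𝓡 n d) (i j : Fin n) (i≢j : i ≢ j)
                       {L† : Matrices.Matrix 𝓡 n n}
                       (penrose : Matrices.IsMoorePenroseInverse 𝓡 (ConnectionGraph.L G) L†)
                       (D† : Matrices.Matrix 𝓡 (length (ConnectionGraph.others G i j) ℕ.* d) (length (ConnectionGraph.others G i j) ℕ.* d))
                       (penrose-D : Matrices.IsMoorePenroseInverse 𝓡 (ConnectionGraph.𝓛-others G i j) D†) where
  open RealNumbers 𝓡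
  open Matrices 𝓡
  open FieldProperties orderedField
  open Limits 𝓡
  open ConnectionGraph G
  open Laplacian G
  open KilledWalk G i j i≢j
  open Stopping G i j i≢j penrose
  open SumReindexing orderedField
  open MatrixAction 𝓡
  open ≡-Reasoning

  S : List (Fin n)
  S = others i j

  T : Set
  T = Fin (length S ℕ.* d)

  vertex : T → Fin n
  vertex p = List.lookup S (proj₁ (remQuot {length S} d p))

  index : T → Fin d
  index p = proj₂ (remQuot {length S} d p)

  D : Matrix (length S ℕ.* d) (length S ℕ.* d)
  D = 𝓛-others i j

  -- Passes from positions in the list of interior vertices to all vertices weighted by `χ`, the
  -- form in which `Q` is given.
  sum-others : ∀ (f : Fin n → Fin d → ℝ) → sum {length S ℕ.* d} (λ p → f (vertex p) (index p)) ≡ sum λ y → χ y * sum (f y)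
  sum-others f = begin
    sum {length S ℕ.* d} (λ p → f (vertex p) (index p))
      ≡⟨ sum-remQuot (length S) d (λ s → f (List.lookup S s)) ⟩
    sum {length S} (λ s → sum (f (List.lookup S s)))
      ≡⟨ sum-filter interior? (λ y → sum (f y)) (allFin n) ⟩
    sum {length (allFin n)} (λ s → χ (List.lookup (allFin n) s) * sum (f (List.lookup (allFin n) s)))
      ≡⟨ sum-tabulate (λ x → x) (λ y → χ y * sum (f y)) ⟩
    sum (λ y → χ y * sum (f y)) ∎

  vertex-interior : ∀ p → vertex p ≢ i × vertex p ≢ j
  vertex-interior p = All.lookup (all-filter interior? (allFin n)) (∈-lookup (proj₁ (remQuot {length S} d p)))

  -- Interior vertices are listed without repetition, so vertex and coordinate together determine
  -- the position.
  kronecker-T : ∀ p o → I (vertex p) (vertex o) * I (index p) (index o) ≡ I p o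
  kronecker-T p o with p Fin.≟ o
  ... | yes refl = trans (cong₂ _*_ (kronecker-refl (vertex p)) (kronecker-refl (index p))) (*-identityˡ _)
  ... | no  p≢o  = by-cases (vertex p Fin.≟ vertex o) (index p Fin.≟ index o)
    where
    by-cases : Dec (vertex p ≡ vertex o) → Dec (index p ≡ index o) → I (vertex p) (vertex o) * I (index p) (index o) ≡ 0#
    by-cases (no x≢y) _ = trans (cong (_* I (index p) (index o)) (kronecker-≢ x≢y)) (zeroˡ _)
    by-cases (yes _) (no r≢c) = trans (cong (I (vertex p) (vertex o) *_) (kronecker-≢ r≢c)) (zeroʳ _)
    by-cases (yes x≡y) (yes r≡c) = contradiction p≡o p≢o
      where
      s≡t : proj₁ (remQuot {length S} d p) ≡ proj₁ (remQuot {length S} d o)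
      s≡t = lookup-injective (filter⁺ interior? (allFin⁺ n)) _ _ x≡y
      p≡o : p ≡ o
      p≡o = trans (sym (Fin.combine-remQuot {length S} d p))
        (trans (cong₂ combine s≡t r≡c) (Fin.combine-remQuot {length S} d o))

  -- One formula covers both cases: for `x = y` the `σ` term has weight `w x x = 0`, whatever
  -- `σ x x` may be.
  𝓛-block : ∀ x y r c → block d 𝓛 x y r c ≡ deg x * (I x y * I r c) - w x y * σ x y r c
  𝓛-block x y r c = trans
    (cong₂ (λ xr yc → (if does (proj₁ xr Fin.≟ proj₁ yc) then deg (proj₁ xr) • I else (- w (proj₁ xr) (proj₁ yc)) • σ (proj₁ xr) (proj₁ yc)) (proj₂ xr) (proj₂ yc))
      (Fin.remQuot-combine {n} x r) (Fin.remQuot-combine {n} y c)) entry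
    where
    entry : (if does (x Fin.≟ y) then deg x • I else (- w x y) • σ x y) r c ≡ deg x * (I x y * I r c) - w x y * σ x y r c
    entry with x Fin.≟ y
    ... | yes refl = sym (trans (cong₂ (λ a b → deg x * (a * I r c) - b * σ x x r c) refl (w-loopless x))
            (solve 3 (λ a b s → a :* (con (ℤ.+ 1) :* b) :- con (ℤ.+ 0) :* s := a :* b) refl (deg x) (I r c) (σ x x r c)))
    ... | no  _ = solve 4 (λ a b w s → :- w :* s := a :* (con (ℤ.+ 0) :* b) :- w :* s) refl (deg x) (I r c) (w x y) (σ x y r c)

  -- Row `(x , r)` of `-𝓛` without its diagonal, applied to an interior vector. Interior `x` give
  -- the off-diagonal part of `D`, and `i` and `j` give the coupling block of the Schur complement.
  wσ-sum : (T → ℝ) → Fin n → Fin d → ℝ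
  wσ-sum v x r = sum λ p → w x (vertex p) * σ x (vertex p) r (index p) * v p

  D-apply : ∀ v p → apply D v p ≡ deg (vertex p) * v p - wσ-sum v (vertex p) (index p)
  D-apply v p = begin
    sum (λ o → D p o * v o)
      ≡⟨ sum-cong-≗ (λ o → trans (cong (_* v o) (trans (𝓛-block (vertex p) (vertex o) (index p) (index o))
           (cong (λ z → deg (vertex p) * z - wσ o) (kronecker-T p o))))
           (solve 4 (λ a b s v → (a :* b :- s) :* v := a :* (b :* v) :- s :* v) refl (deg (vertex p)) (I p o) (wσ o) (v o))) ⟩
    sum (λ o → deg (vertex p) * (I p o * v o) - wσ o * v o)
      ≡⟨ sum-- (λ o → deg (vertex p) * (I p o * v o)) _ ⟩
    sum (λ o → deg (vertex p) * (I p o * v o)) - wσ-sum v (vertex p) (index p)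
      ≡⟨ cong (_- wσ-sum v (vertex p) (index p)) (trans (sym (*-sumˡ (deg (vertex p)) (λ o → I p o * v o))) (cong (deg (vertex p) *_) (sum-kronecker p v))) ⟩
    deg (vertex p) * v p - wσ-sum v (vertex p) (index p) ∎
    where
    wσ : T → ℝ
    wσ o = w (vertex p) (vertex o) * σ (vertex p) (vertex o) (index p) (index o)

  -- The bridge between walk and matrix: the degree turns transition probabilities into edge
  -- weights, and so the twisted walk into rows of `𝓛`.
  deg*transported : ∀ H x r → deg x * transported H x r ≡ wσ-sum (λ p → H (vertex p) (index p)) x r
  deg*transported H x r = begin
    deg x * sum (λ y → χ y * P x y * sum λ k → σ x y r k * H y k)
      ≡⟨ *-sumˡ (deg x) (λ y → χ y * P x y * sum λ k → σ x y r k * H y k) ⟩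
    sum (λ y → deg x * (χ y * P x y * sum λ k → σ x y r k * H y k))
      ≡⟨ sum-cong-≗ (λ y → trans (solve 4 (λ a c p s → a :* (c :* p :* s) := c :* (a :* p :* s)) refl (deg x) (χ y) (P x y) (sum λ k → σ x y r k * H y k))
           (cong (χ y *_) (trans (cong (_* sum λ k → σ x y r k * H y k) (deg*P (0<deg x) y))
             (trans (*-sumˡ (w x y) (λ k → σ x y r k * H y k)) (sum-cong-≗ λ k → sym (*-assoc (w x y) (σ x y r k) (H y k))))))) ⟩
    sum (λ y → χ y * sum λ k → w x y * σ x y r k * H y k)
      ≡⟨ sym (sum-others (λ y k → w x y * σ x y r k * H y k)) ⟩
    wσ-sum (λ p → H (vertex p) (index p)) x r ∎

  -- A kernel vector extends to a fixed point of transported, which decays.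
  D-injective : ∀ v → (∀ p → apply D v p ≡ 0#) → ∀ p → v p ≡ 0#
  D-injective v Dv≡0 p = trans (v≡v̂ p) (⟶-unique (⟶-const _) (decay-transported (λ _ → v̂) (λ _ → fixed) (vertex p) (index p)))
    where
    v̂ : Fin n → Fin d → ℝ
    v̂ x r = deg x ⁻¹ * wσ-sum v x r
    deg*v̂ : ∀ x r → deg x * v̂ x r ≡ wσ-sum v x r
    deg*v̂ x r = trans (sym (*-assoc _ _ _)) (trans (cong (_* wσ-sum v x r) (*-inverseʳ _ (positive≢0 (0<deg x)))) (*-identityˡ _))
    v≡v̂ : ∀ p → v p ≡ v̂ (vertex p) (index p)
    v≡v̂ p = *-cancelˡ (positive≢0 (0<deg (vertex p))) (trans
      (x-y≡0⇒x≡y _ _ (trans (sym (D-apply v p)) (Dv≡0 p))) (sym (deg*v̂ (vertex p) (index p))))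
    fixed : ∀ x r → v̂ x r ≡ transported v̂ x r
    fixed x r = *-cancelˡ (positive≢0 (0<deg x)) (trans (deg*v̂ x r) (trans
      (sum-cong-≗ λ p → cong (w x (vertex p) * σ x (vertex p) r (index p) *_) (v≡v̂ p)) (sym (deg*transported v̂ x r))))

  -- `D · D† · D ≋ D` says that `D` annihilates the difference of the two sides, and `D` is
  -- injective.
  D†-left-inverse : ∀ v p → apply D† (apply D v) p ≡ v p
  D†-left-inverse v p = x-y≡0⇒x≡y _ _ (D-injective (λ o → apply D† (apply D v) o - v o) (λ o → begin
    apply D (λ o → apply D† (apply D v) o - v o) o
      ≡⟨ apply-- D (apply D† (apply D v)) v o ⟩
    apply D (apply D† (apply D v)) o - apply D v o
      ≡⟨ cong (_- apply D v o) (trans (sym (apply-· D D† (apply D v) o)) (trans (sym (apply-· (D · D†) D v o))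
           (sum-cong-≗ λ k → cong (_* v k) (IsMoorePenroseInverse.AA†A≋A penrose-D o k)))) ⟩
    apply D v o - apply D v o
      ≡⟨ -‿inverseʳ _ ⟩
    0# ∎) p)

  -- Fixing a column `c` is possible because paths are extended at their start: `σ` multiplies the
  -- transport from the left and columns do not mix.
  record Transports (b : Fin n) (c : Fin d) (H : ℕ → Fin n → Fin d → ℝ) : Set where
    field
      one-step  : ∀ x r → H 0 x r ≡ P x b * σ x b r c
      recursion : ∀ t x r → H (suc t) x r ≡ transported (H t) x r

    cumulative : ℕ → Fin n → Fin d → ℝ
    cumulative M x r = partialSums (λ t → H t x r) M

    cumulative-suc : ∀ M x r → cumulative (suc M) x r ≡ P x b * σ x b r c + transported (cumulative M) x r
    cumulative-suc M x r = cong₂ _+_ (one-step x r) (begin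
      sum {M} (λ t → H (suc (toℕ t)) x r)
        ≡⟨ sum-cong-≗ {M} (λ t → recursion (toℕ t) x r) ⟩
      sum {M} (λ t → sum λ y → q x y * sum λ k → σ x y r k * H (toℕ t) y k)
        ≡⟨ ∑-comm {M} {n} (λ t y → q x y * sum λ k → σ x y r k * H (toℕ t) y k) ⟩
      sum (λ y → sum {M} λ t → q x y * sum λ k → σ x y r k * H (toℕ t) y k)
        ≡⟨ sum-cong-≗ (λ y → trans (sym (*-sumˡ {M} (q x y) (λ t → sum λ k → σ x y r k * H (toℕ t) y k)))
             (cong (q x y *_) (trans (∑-comm {M} {d} (λ t k → σ x y r k * H (toℕ t) y k))
               (sum-cong-≗ λ k → sym (*-sumˡ {M} (σ x y r k) (λ t → H (toℕ t) y k)))))) ⟩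
      transported (cumulative M) x r ∎)

    -- Column `c` of the block of `-𝓛` from the interior to `b`.
    boundary : T → ℝ
    boundary p = w (vertex p) b * σ (vertex p) b (index p) c

    remainder : ℕ → T → ℝ
    remainder M p = deg (vertex p) * H M (vertex p) (index p)

    -- Adding the term `H M` to the partial sum gives `cumulative (suc M)`, and so does prepending a
    -- first step. Equating the two and multiplying by the degree leaves `H M` as the error.
    D-cumulative : ∀ M p → apply D (λ o → cumulative M (vertex o) (index o)) p ≡ boundary p - remainder M p
    D-cumulative M p = begin
      apply D (λ o → cumulative M (vertex o) (index o)) p
        ≡⟨ D-apply (λ o → cumulative M (vertex o) (index o)) p ⟩
      deg x * K - wσ-sum (λ o → cumulative M (vertex o) (index o)) x r
        ≡⟨ cong (λ z → deg x * K - z) (sym (deg*transported (cumulative M) x r)) ⟩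
      deg x * K - deg x * transported (cumulative M) x r
        -- The last bracket is made the difference of the two expressions for `cumulative (suc M)`.
        ≡⟨ solve 5 (λ a k t h e → a :* k :- a :* t := a :* (e :- h) :+ a :* ((k :+ h) :- (e :+ t)))
             refl (deg x) K (transported (cumulative M) x r) (H M x r) (P x b * σ x b r c) ⟩
      deg x * (P x b * σ x b r c - H M x r) + deg x * ((K + H M x r) - (P x b * σ x b r c + transported (cumulative M) x r))
        ≡⟨ cong (λ z → deg x * (P x b * σ x b r c - H M x r) + deg x * z)
             (trans (cong₂ _-_ (sym (partialSums-suc (λ t → H t x r) M)) (sym (cumulative-suc M x r))) (-‿inverseʳ _)) ⟩
      deg x * (P x b * σ x b r c - H M x r) + deg x * 0#
        ≡⟨ solve 4 (λ a p s h → a :* (p :* s :- h) :+ a :* con (ℤ.+ 0) := a :* p :* s :- a :* h) refl (deg x) (P x b) (σ x b r c) (H M x r) ⟩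
      deg x * P x b * σ x b r c - deg x * H M x r
        ≡⟨ cong (λ z → z * σ x b r c - deg x * H M x r) (deg*P (0<deg x) b) ⟩
      boundary p - remainder M p ∎
      where
      x = vertex p
      r = index p
      K = cumulative M x r

    -- `D†` solves `D-cumulative` exactly for the partial sum; all dependence on `M` then sits in
    -- the decaying remainder.
    cumulative-limit : ∀ p → (λ M → cumulative M (vertex p) (index p)) ⟶ apply D† boundary p
    cumulative-limit p = ⟶-cong rewritten
      (subst ((λ M → apply D† (λ o → boundary o + - remainder M o) p) ⟶_)
        (sum-cong-≗ λ o → cong (D† p o *_) (trans (cong (boundary o +_) (solve 1 (λ a → :- (a :* con (ℤ.+ 0)) := con (ℤ.+ 0)) refl (deg (vertex o)))) (+-identityʳ _)))
        (⟶-sum λ o → ⟶-* (D† p o) (⟶-+ (⟶-const (boundary o))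
          (⟶-neg (⟶-* (deg (vertex o)) (decay-transported H recursion (vertex o) (index o)))))))
      where
      rewritten : ∀ M → apply D† (λ o → boundary o + - remainder M o) p ≡ cumulative M (vertex p) (index p)
      rewritten M = trans (sum-cong-≗ λ o → cong (D† p o *_) (sym (D-cumulative M o)))
        (D†-left-inverse (λ o → cumulative M (vertex o) (index o)) p)

    -- First step from `a`: directly to `b`, or to an interior vertex, where `apply D† boundary` is
    -- the limit already found.
    total : Fin n → Fin d → ℝ
    total a r = deg a ⁻¹ * (w a b * σ a b r c + wσ-sum (apply D† boundary) a r)

    deg*total : ∀ a r → deg a * total a r ≡ w a b * σ a b r c + wσ-sum (apply D† boundary) a r
    deg*total a r = trans (sym (*-assoc _ _ _))
      (trans (cong (_* (w a b * σ a b r c + wσ-sum (apply D† boundary) a r)) (*-inverseʳ _ (positive≢0 (0<deg a)))) (*-identityˡ _))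

    -- `cumulative-suc` expresses the partial sums at any `a`, `i` and `j` included, through the
    -- interior ones with one term fewer; hence the shift by `⟶-pred`.
    hasSum : ∀ a r → HasSum (λ t → H t a r) (total a r)
    hasSum a r = ⟶-pred (⟶-cong (λ M → trans (cong (deg a ⁻¹ *_) (rewritten M))
        (trans (sym (*-assoc _ _ _)) (trans (cong (_* cumulative (suc M) a r) (*-inverseˡ _ (positive≢0 (0<deg a)))) (*-identityˡ _))))
      (⟶-* (deg a ⁻¹) (⟶-+ (⟶-const (w a b * σ a b r c))
        (⟶-sum λ p → ⟶-* (w a (vertex p) * σ a (vertex p) r (index p)) (cumulative-limit p)))))
      where
      rewritten : ∀ M → w a b * σ a b r c + wσ-sum (λ p → cumulative M (vertex p) (index p)) a r ≡ deg a * cumulative (suc M) a r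
      rewritten M = begin
        w a b * σ a b r c + wσ-sum (λ p → cumulative M (vertex p) (index p)) a r
          ≡⟨ cong₂ _+_ (cong (_* σ a b r c) (sym (deg*P (0<deg a) b))) (sym (deg*transported (cumulative M) a r)) ⟩
        deg a * P a b * σ a b r c + deg a * transported (cumulative M) a r
          ≡⟨ solve 4 (λ a p s t → a :* p :* s :+ a :* t := a :* (p :* s :+ t)) refl (deg a) (P a b) (σ a b r c) (transported (cumulative M) a r) ⟩
        deg a * (P a b * σ a b r c + transported (cumulative M) a r)
          ≡⟨ cong (deg a *_) (sym (cumulative-suc M a r)) ⟩
        deg a * cumulative (suc M) a r ∎

    -- The hypotheses place `a` and `b` outside the interior, so the coupling blocks consist of
    -- off-diagonal entries of `𝓛`. Their minus signs cancel, and the edge from `a` to `b` together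
    -- with the correction term is the first-step formula `deg*total`.
    schur-entry : ∀ {a} → (∀ {x} → x ≢ i → x ≢ j → x ≢ a) → (∀ {x} → x ≢ i → x ≢ j → x ≢ b) →
                  ∀ r →
                  block d 𝓛 a b r c - sum (λ p → sum (λ o → block d 𝓛 a (vertex o) r (index o) * D† o p) * block d 𝓛 (vertex p) b (index p) c)
                    ≡ deg a * (I a b * I r c) - deg a * total a r
    schur-entry {a} a∉ b∉ r = begin
      block d 𝓛 a b r c - sum (λ p → sum (λ o → block d 𝓛 a (vertex o) r (index o) * D† o p) * block d 𝓛 (vertex p) b (index p) c)
        ≡⟨ cong₂ _-_ (𝓛-block a b r c) (sum-cong-≗ λ p → trans (cong₂ _*_ (sum-cong-≗ λ o → cong (_* D† o p) (row o)) (column p))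
             (trans (*-sumʳ (- boundary p) (λ o → - (wσ o) * D† o p)) (sum-cong-≗ λ o →
               solve 3 (λ s m t → :- s :* m :* :- t := s :* (m :* t)) refl (wσ o) (D† o p) (boundary p)))) ⟩
      block′ - sum (λ p → sum λ o → wσ o * (D† o p * boundary p))
        ≡⟨ cong (λ z → block′ - z) (trans (∑-comm {length S ℕ.* d} {length S ℕ.* d} (λ p o → wσ o * (D† o p * boundary p)))
             (sum-cong-≗ λ o → sym (*-sumˡ (wσ o) (λ p → D† o p * boundary p)))) ⟩
      block′ - wσ-sum (apply D† boundary) a r
        ≡⟨ solve 3 (λ x y z → (x :- y) :- z := x :- (y :+ z)) refl (deg a * (I a b * I r c)) (w a b * σ a b r c) (wσ-sum (apply D† boundary) a r) ⟩
      deg a * (I a b * I r c) - (w a b * σ a b r c + wσ-sum (apply D† boundary) a r)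
        ≡⟨ cong (λ z → deg a * (I a b * I r c) - z) (sym (deg*total a r)) ⟩
      deg a * (I a b * I r c) - deg a * total a r ∎
      where
      block′ : ℝ
      block′ = deg a * (I a b * I r c) - w a b * σ a b r c
      wσ : T → ℝ
      wσ o = w a (vertex o) * σ a (vertex o) r (index o)
      off-diagonal : ∀ {x y} → x ≢ y → ∀ r c → block d 𝓛 x y r c ≡ - (w x y * σ x y r c)
      off-diagonal {x} {y} x≢y r c = trans (𝓛-block x y r c) (trans
        (cong (λ z → deg x * (z * I r c) - w x y * σ x y r c) (kronecker-≢ x≢y))
        (solve 3 (λ a b s → a :* (con (ℤ.+ 0) :* b) :- s := :- s) refl (deg x) (I r c) (w x y * σ x y r c)))
      row : ∀ o → block d 𝓛 a (vertex o) r (index o) ≡ - wσ o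
      row o = off-diagonal (λ a≡x → a∉ (proj₁ (vertex-interior o)) (proj₂ (vertex-interior o)) (sym a≡x)) r (index o)
      column : ∀ p → block d 𝓛 (vertex p) b (index p) c ≡ - boundary p
      column p = off-diagonal (b∉ (proj₁ (vertex-interior p)) (proj₂ (vertex-interior p))) (index p) c

-- Hitting times along a fixed trajectory.

module Paths {A : Set} where

  -- Recursive form of `Follows`: it allows induction from the front of a path with time shifted by
  -- one, and it covers the empty path.
  Along : (ℕ → A) → ∀ {m} → Vec A m → Set
  Along p []       = ⊤
  Along p (x ∷ xs) = p 0 ≡ x × Along (p ∘ suc) xs

  Along⇔pointwise : ∀ p {m} (xs : Vec A m) → Along p xs ⇔ (∀ s → p (toℕ s) ≡ Vec.lookup xs s)
  Along⇔pointwise p xs = mk⇔ (to p xs) (from p xs)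
    where
    to : ∀ p {m} (xs : Vec A m) → Along p xs → ∀ s → p (toℕ s) ≡ Vec.lookup xs s
    to p (x ∷ xs) (eq , _)   zero    = eq
    to p (x ∷ xs) (_ , rest) (suc s) = to (p ∘ suc) xs rest s
    from : ∀ p {m} (xs : Vec A m) → (∀ s → p (toℕ s) ≡ Vec.lookup xs s) → Along p xs
    from p []       _  = tt
    from p (x ∷ xs) eq = eq zero , from (p ∘ suc) xs (eq ∘ suc)

  Along-∷ʳ : ∀ p {m} (xs : Vec A m) y → Along p (xs ∷ʳ y) ⇔ (Along p xs × p m ≡ y)
  Along-∷ʳ p xs y = mk⇔ (to p xs) (from p xs)
    where
    to : ∀ p {m} (xs : Vec A m) → Along p (xs ∷ʳ y) → Along p xs × p m ≡ y
    to p []       (eq , _) = tt , eq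
    to p (x ∷ xs) (eq , rest) with to (p ∘ suc) xs rest
    ... | along , last = (eq , along) , last
    from : ∀ p {m} (xs : Vec A m) → Along p xs × p m ≡ y → Along p (xs ∷ʳ y)
    from p []       (_ , eq) = eq , tt
    from p (x ∷ xs) ((eq , along) , last) = eq , from (p ∘ suc) xs (along , last)

  -- Along the walk this is by definition the case `t` of the event `T¹[ b ]<T¹[ k ]`, so countable
  -- additivity applies to that event as it stands.
  Hits : A → A → (ℕ → A) → ℕ → Set
  Hits b k p t = (1 ℕ.≤ t × p t ≡ b × (∀ s → 1 ℕ.≤ s → s ℕ.< t → p s ≢ b)) × (∀ s → 1 ℕ.≤ s → s ℕ.≤ t → p s ≢ k)

  -- The first entry is unrestricted and a lone vertex is no hitting path, because `T¹` ignores time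
  -- 0.
  HittingPath : A → A → ∀ {t} → Vec A (suc t) → Set
  HittingPath b k (x ∷ [])         = ⊥
  HittingPath b k (x ∷ y ∷ [])     = y ≡ b
  HittingPath b k (x ∷ y ∷ z ∷ zs) = (y ≢ b × y ≢ k) × HittingPath b k (y ∷ z ∷ zs)

  Hits⇒HittingPath : ∀ {b k} p {t} (xs : Vec A (suc t)) → Along p xs → Hits b k p t → HittingPath b k xs
  Hits⇒HittingPath p (x ∷ [])         along ((() , _) , _)
  Hits⇒HittingPath p (x ∷ y ∷ [])     (_ , refl , _) ((_ , hit , _) , _) = hit
  Hits⇒HittingPath p (x ∷ y ∷ z ∷ zs) (_ , eq , rest) ((_ , hit , b∉) , k∉) =
    (subst (_≢ _) eq (b∉ 1 (ℕ.s≤s ℕ.z≤n) (ℕ.s≤s (ℕ.s≤s ℕ.z≤n))) , subst (_≢ _) eq (k∉ 1 (ℕ.s≤s ℕ.z≤n) (ℕ.s≤s ℕ.z≤n))) ,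
    Hits⇒HittingPath (p ∘ suc) (y ∷ z ∷ zs) (eq , rest)
      ((ℕ.s≤s ℕ.z≤n , hit , λ s _ s<t → b∉ (suc s) (ℕ.s≤s ℕ.z≤n) (ℕ.s≤s s<t)) ,
       λ s _ s≤t → k∉ (suc s) (ℕ.s≤s ℕ.z≤n) (ℕ.s≤s s≤t))

  -- `b ≢ k` settles the last time, when the trajectory is at `b` and must not be at `k`.
  HittingPath⇒Hits : ∀ {b k} → b ≢ k → ∀ p {t} (xs : Vec A (suc t)) → Along p xs → HittingPath b k xs → Hits b k p t
  HittingPath⇒Hits b≢k p (x ∷ y ∷ []) (_ , refl , _) refl =
    (ℕ.s≤s ℕ.z≤n , refl , λ { (suc s) _ (ℕ.s≤s ()) }) , λ { (suc zero) _ _ → b≢k ; (suc (suc s)) _ (ℕ.s≤s ()) }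
  HittingPath⇒Hits b≢k p (x ∷ y ∷ z ∷ zs) (_ , refl , rest) ((y≢b , y≢k) , hitting)
    with HittingPath⇒Hits b≢k (p ∘ suc) (y ∷ z ∷ zs) (refl , rest) hitting
  ... | (_ , hit , b∉) , k∉ =
    (ℕ.s≤s ℕ.z≤n , hit , λ { (suc zero) _ _ → y≢b ; (suc (suc s)) _ (ℕ.s≤s s<t) → b∉ (suc s) (ℕ.s≤s ℕ.z≤n) s<t }) ,
    λ { (suc zero) _ _ → y≢k ; (suc (suc s)) _ (ℕ.s≤s s≤t) → k∉ (suc s) (ℕ.s≤s ℕ.z≤n) s≤t }

-- Path probabilities from the measure axioms and the Markov property.

module Probability {𝓡 : RealNumbers} {n d : ℕ} {G : ConnectionGraph 𝓡 n d} (walk : SimpleRandomWalk G) where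
  open RealNumbers 𝓡
  open Matrices 𝓡
  open FieldProperties orderedField
  open Limits 𝓡
  open ConnectionGraph G
  open Laplacian G using (P)
  open SimpleRandomWalk walk
  open Paths {Fin n}
  open IsSigmaAlgebra isSigmaAlgebra using (universe; complement; intersect) renaming (respects to event-respects)
  open ≡-Reasoning

  event-∅ : IsEvent (λ _ → ⊥)
  event-∅ = event-respects (λ _ → mk⇔ (λ ¬⊤ → ¬⊤ tt) (λ ())) (complement universe)

  event-× : ∀ {A B} → IsEvent A → IsEvent B → IsEvent (λ ω → A ω × B ω)
  event-× {A} {B} eA eB = event-respects (λ ω → mk⇔ (λ p → p 0 , p 1) (λ { (a , b) zero → a ; (a , b) (suc _) → b }))
    (intersect {λ { zero → A ; (suc _) → B }} λ { zero → eA ; (suc _) → eB })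

  event-→ : ∀ {A} {C : Set} → Dec C → IsEvent A → IsEvent (λ ω → C → A ω)
  event-→ (yes c) eA = event-respects (λ _ → mk⇔ (λ a _ → a) (λ f → f c)) eA
  event-→ (no ¬c) eA = event-respects (λ _ → mk⇔ (λ _ c → contradiction c ¬c) (λ _ → tt)) universe

  event-const× : ∀ {A} {C : Set} → Dec C → IsEvent A → IsEvent (λ ω → C × A ω)
  event-const× (yes c) eA = event-respects (λ _ → mk⇔ (λ a → c , a) proj₂) eA
  event-const× (no ¬c) eA = event-respects (λ _ → mk⇔ (λ ()) (λ p → ¬c (proj₁ p))) event-∅

  event-Along : ∀ (Y : ℕ → Ω → Fin n) → (∀ t x → IsEvent (λ ω → Y t ω ≡ x)) →
                ∀ {m} (xs : Vec (Fin n) m) → IsEvent (λ ω → Along (λ t → Y t ω) xs)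
  event-Along Y eY []       = universe
  event-Along Y eY (x ∷ xs) = event-× (eY 0 x) (event-Along (Y ∘ suc) (eY ∘ suc) xs)

  event-Hits : ∀ b k t → IsEvent (λ ω → Hits b k (λ s → X s ω) t)
  event-Hits b k t = event-×
    (event-const× (1 ℕ.≤? t) (event-× (X-measurable t b)
      (intersect λ s → event-→ (1 ℕ.≤? s) (event-→ (s ℕ.<? t) (complement (X-measurable s b))))))
    (intersect λ s → event-→ (1 ℕ.≤? s) (event-→ (s ℕ.≤? t) (complement (X-measurable s k))))

  sumVec-cong : ∀ m {f g : Vec (Fin n) m → ℝ} → (∀ xs → f xs ≡ g xs) → sumVec m f ≡ sumVec m g
  sumVec-cong zero    p = p []
  sumVec-cong (suc m) p = sum-cong-≗ λ x → sumVec-cong m λ xs → p (x ∷ xs)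

  module _ (a : Fin n) where
    open IsProbabilityMeasure (isProbability a)

    -- With `A` in every slot of `additive`, disjointness is vacuous; the terms of a convergent
    -- series tend to 0, so the constant term is 0.
    ℙ-impossible : ∀ {A} → IsEvent A → (∀ ω → ¬ A ω) → ℙ a A ≡ 0#
    ℙ-impossible {A} eA ¬A = ⟶-unique (⟶-const (ℙ a A))
      (HasSum⇒0⟵ (additive {λ _ → A} (λ _ → eA) (λ _ _ _ ω p → ¬A ω (proj₁ p))))

    -- The values of `Z` are read as natural numbers to fit `additive`; the slices from `n` on are
    -- empty, which leaves a finite sum.
    ℙ-partition : ∀ {A} → IsEvent A → (Z : Ω → Fin n) → (∀ x → IsEvent (λ ω → Z ω ≡ x)) →
                  ℙ a A ≡ sum λ x → ℙ a (λ ω → A ω × Z ω ≡ x)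
    ℙ-partition {A} eA Z eZ = begin
      ℙ a A
        ≡⟨ respects (λ ω → mk⇔ (λ α → toℕ (Z ω) , α , refl) (λ p → proj₁ (proj₂ p))) eA ⟩
      ℙ a (λ ω → ∃[ m ] B m ω)
        ≡⟨ HasSum-finite n (λ m n≤m → ℙ-impossible (event-B m) (λ ω p → ℕ.<⇒≱ (subst (ℕ._< n) (proj₂ p) (Fin.toℕ<n (Z ω))) n≤m))
             (additive event-B (λ m m′ m≢m′ ω p → m≢m′ (trans (sym (proj₂ (proj₁ p))) (proj₂ (proj₂ p))))) ⟩
      sum {n} (λ x → ℙ a (B (toℕ x)))
        ≡⟨ sum-cong-≗ (λ x → respects (λ ω → mk⇔ (λ p → proj₁ p , Fin.toℕ-injective (proj₂ p)) (λ p → proj₁ p , cong toℕ (proj₂ p))) (event-B (toℕ x))) ⟩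
      sum (λ x → ℙ a (λ ω → A ω × Z ω ≡ x)) ∎
      where
      B : ℕ → Ω → Set
      B m ω = A ω × toℕ (Z ω) ≡ m
      event-B : ∀ m → IsEvent (B m)
      event-B m with m ℕ.<? n
      ... | yes m<n = event-respects (λ ω → mk⇔
              (λ p → proj₁ p , trans (cong toℕ (proj₂ p)) (Fin.toℕ-fromℕ< m<n))
              (λ p → proj₁ p , Fin.toℕ-injective (trans (proj₂ p) (sym (Fin.toℕ-fromℕ< m<n)))))
              (event-× eA (eZ (fromℕ< m<n)))
      ... | no  m≮n = event-respects (λ ω → mk⇔ (λ ()) (λ p → m≮n (subst (ℕ._< n) (proj₂ p) (Fin.toℕ<n (Z ω))))) event-∅

    -- The process `Y` is a parameter so that the induction can shift it in time.
    ℙ-paths : ∀ m {A} → IsEvent A → (Y : ℕ → Ω → Fin n) → (∀ t x → IsEvent (λ ω → Y t ω ≡ x)) →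
              ℙ a A ≡ sumVec m λ xs → ℙ a (λ ω → A ω × Along (λ t → Y t ω) xs)
    ℙ-paths zero        eA Y eY = respects (λ _ → mk⇔ (λ α → α , tt) proj₁) eA
    ℙ-paths (suc m) {A} eA Y eY = begin
      ℙ a A
        ≡⟨ ℙ-partition eA (Y 0) (eY 0) ⟩
      sum (λ x → ℙ a (λ ω → A ω × Y 0 ω ≡ x))
        ≡⟨ sum-cong-≗ (λ x → ℙ-paths m (event-× eA (eY 0 x)) (Y ∘ suc) (eY ∘ suc)) ⟩
      sum (λ x → sumVec m λ xs → ℙ a (λ ω → (A ω × Y 0 ω ≡ x) × Along (λ t → Y (suc t) ω) xs))
        ≡⟨ sum-cong-≗ (λ x → sumVec-cong m λ xs → respects
             (λ ω → mk⇔ (λ { ((α , eq) , along) → α , eq , along }) (λ { (α , eq , along) → (α , eq) , along }))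
             (event-× (event-× eA (eY 0 x)) (event-Along (Y ∘ suc) (eY ∘ suc) xs))) ⟩
      sumVec (suc m) (λ xs → ℙ a (λ ω → A ω × Along (λ t → Y t ω) xs)) ∎

    -- `start` fixes the mass at `a`, so the excess over `I a` is nowhere negative; it sums to
    -- `1# - 1#`, so every term vanishes.
    ℙ-start : ∀ x → ℙ a (λ ω → X 0 ω ≡ x) ≡ I a x
    ℙ-start x = x-y≡0⇒x≡y _ _ (sum≡0⇒term≡0 excess-nonneg (begin
      sum (λ y → ℙ a (λ ω → X 0 ω ≡ y) - I a y)
        ≡⟨ sum-- (λ y → ℙ a (λ ω → X 0 ω ≡ y)) (I a) ⟩
      sum (λ y → ℙ a (λ ω → X 0 ω ≡ y)) - sum (I a)
        ≡⟨ cong₂ _-_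
             (trans (sum-cong-≗ λ y → respects (λ ω → mk⇔ (λ eq → tt , eq) proj₂) (X-measurable 0 y))
               (trans (sym (ℙ-partition universe (X 0) (X-measurable 0))) total))
             (trans (sum-cong-≗ λ y → sym (*-identityʳ (I a y))) (sum-kronecker a (λ _ → 1#))) ⟩
      1# - 1#
        ≡⟨ -‿inverseʳ 1# ⟩
      0# ∎) x)
      where
      excess-nonneg : ∀ y → 0# ≤ ℙ a (λ ω → X 0 ω ≡ y) - I a y
      excess-nonneg y = by-cases (a Fin.≟ y)
        where
        by-cases : Dec (a ≡ y) → 0# ≤ ℙ a (λ ω → X 0 ω ≡ y) - I a y
        by-cases (yes refl) = x≤y⇒0≤y-x (≤-reflexive (trans (kronecker-refl a) (sym (start a))))
        by-cases (no  a≢y)  = x≤y⇒0≤y-x (subst (_≤ ℙ a (λ ω → X 0 ω ≡ y)) (sym (kronecker-≢ a≢y)) (nonneg (X-measurable 0 y)))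

  weight : ∀ {t} → Vec (Fin n) (suc t) → ℝ
  weight (x ∷ [])     = 1#
  weight (x ∷ y ∷ xs) = P x y * weight (y ∷ xs)

  weight-∷ʳ : ∀ {t} (xs : Vec (Fin n) (suc t)) y → weight (xs ∷ʳ y) ≡ weight xs * P (Vec.last xs) y
  weight-∷ʳ (x ∷ [])      y = trans (*-identityʳ _) (sym (*-identityˡ _))
  weight-∷ʳ (x ∷ x′ ∷ xs) y = trans (cong (P x x′ *_) (weight-∷ʳ (x′ ∷ xs) y)) (sym (*-assoc _ _ _))

  event-path : ∀ {m} (xs : Vec (Fin n) m) → IsEvent (λ ω → Along (λ t → X t ω) xs)
  event-path = event-Along X X-measurable

  Along⇔Follows : ∀ {t} (xs : Vec (Fin n) (suc t)) ω → Along (λ t → X t ω) xs ⇔ Follows xs ω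
  Along⇔Follows xs ω = Along⇔pointwise (λ t → X t ω) xs

  -- `markov` extends a path at its end while `weight` recurses from its start; `weight-∷ʳ`
  -- reconciles the two.
  ℙ-path : ∀ a {t} (xs : Vec (Fin n) (suc t)) → ℙ a (λ ω → Along (λ t → X t ω) xs) ≡ I a (Vec.head xs) * weight xs
  ℙ-path a {zero} (x ∷ []) = trans
    (IsProbabilityMeasure.respects (isProbability a) (λ ω → mk⇔ proj₁ (λ eq → eq , tt)) (event-path (x ∷ [])))
    (trans (ℙ-start a x) (sym (*-identityʳ _)))
  ℙ-path a {suc t} xs with Vec.initLast xs
  ... | ys , y , refl = begin
    ℙ a (λ ω → Along (λ t → X t ω) (ys ∷ʳ y))
      ≡⟨ respects (λ ω → mk⇔
           (λ p → let q = Equivalence.to (Along-∷ʳ (λ t → X t ω) ys y) p in Equivalence.to (Along⇔Follows ys ω) (proj₁ q) , proj₂ q)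
           (λ p → Equivalence.from (Along-∷ʳ (λ t → X t ω) ys y) (Equivalence.from (Along⇔Follows ys ω) (proj₁ p) , proj₂ p)))
         (event-path (ys ∷ʳ y)) ⟩
    ℙ a (λ ω → Follows ys ω × X (suc t) ω ≡ y)
      ≡⟨ markov a ys y ⟩
    ℙ a (Follows ys) * P (Vec.last ys) y
      ≡⟨ cong (_* P (Vec.last ys) y) (trans (sym (respects (Along⇔Follows ys) (event-path ys))) (ℙ-path a ys)) ⟩
    I a (Vec.head ys) * weight ys * P (Vec.last ys) y
      ≡⟨ *-assoc _ _ _ ⟩
    I a (Vec.head ys) * (weight ys * P (Vec.last ys) y)
      ≡⟨ cong₂ (λ x z → I a x * z) (head-∷ʳ ys) (sym (weight-∷ʳ ys y)) ⟩
    I a (Vec.head (ys ∷ʳ y)) * weight (ys ∷ʳ y) ∎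
    where
    open IsProbabilityMeasure (isProbability a)
    head-∷ʳ : ∀ {t} (ys : Vec (Fin n) (suc t)) → Vec.head ys ≡ Vec.head (ys ∷ʳ y)
    head-∷ʳ (_ ∷ _) = refl

-- First-hit probabilities and transports as sums over paths.

module HittingSums {𝓡 : RealNumbers} {n d : ℕ} {G : ConnectionGraph 𝓡 n d} (walk : SimpleRandomWalk G)
                   (b k : Fin n) (b≢k : b ≢ k) (χ : Fin n → RealNumbers.ℝ 𝓡)
                   (χ-interior : ∀ {y} → y ≢ b → y ≢ k → χ y ≡ RealNumbers.1# 𝓡)
                   (χ-boundary : ∀ {y} → ¬ (y ≢ b × y ≢ k) → χ y ≡ RealNumbers.0# 𝓡) where
  open RealNumbers 𝓡
  open Matrices 𝓡
  open FieldProperties orderedField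
  open Limits 𝓡
  open ConnectionGraph G
  open Laplacian G using (P; deg-positive; P-nonneg)
  open SimpleRandomWalk walk
  open Paths {Fin n}
  open Probability walk
  open ≡-Reasoning

  HittingPath? : ∀ {t} (xs : Vec (Fin n) (suc t)) → Dec (HittingPath b k xs)
  HittingPath? (x ∷ [])         = no λ ()
  HittingPath? (x ∷ y ∷ [])     = y Fin.≟ b
  HittingPath? (x ∷ y ∷ z ∷ zs) = (¬? (y Fin.≟ b) ×-dec ¬? (y Fin.≟ k)) ×-dec HittingPath? (y ∷ z ∷ zs)

  -- The path weight with the conditions of `HittingPath` as factors 0 or 1, so that sums over all
  -- paths obey the recursion of `Q` without case distinctions.
  hitWeight : ∀ {t} → Vec (Fin n) (suc t) → ℝ
  hitWeight (x ∷ [])         = 0#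
  hitWeight (x ∷ y ∷ [])     = P x y * I b y
  hitWeight (x ∷ y ∷ z ∷ zs) = χ y * P x y * hitWeight (y ∷ z ∷ zs)

  hitWeight-hitting : ∀ {t} (xs : Vec (Fin n) (suc t)) → HittingPath b k xs → hitWeight xs ≡ weight xs
  hitWeight-hitting (x ∷ y ∷ [])     refl = cong (P x y *_) (kronecker-refl y)
  hitWeight-hitting (x ∷ y ∷ z ∷ zs) ((y≢b , y≢k) , hitting) =
    cong₂ _*_ (trans (cong (_* P x y) (χ-interior y≢b y≢k)) (*-identityˡ _)) (hitWeight-hitting (y ∷ z ∷ zs) hitting)

  hitWeight-avoiding : ∀ {t} (xs : Vec (Fin n) (suc t)) → ¬ HittingPath b k xs → hitWeight xs ≡ 0#
  hitWeight-avoiding (x ∷ [])         _ = refl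
  hitWeight-avoiding (x ∷ y ∷ [])     ¬hitting = trans (cong (P x y *_) (kronecker-≢ (¬hitting ∘ sym))) (zeroʳ _)
  hitWeight-avoiding (x ∷ y ∷ z ∷ zs) ¬hitting with HittingPath? (y ∷ z ∷ zs) | hitWeight-avoiding (y ∷ z ∷ zs)
  ... | no ¬p | avoiding = trans (cong (χ y * P x y *_) (avoiding ¬p)) (zeroʳ _)
  ... | yes p | _        = trans (cong (λ c → c * P x y * hitWeight (y ∷ z ∷ zs)) (χ-boundary λ q → ¬hitting (q , p)))
                  (solve 2 (λ p h → con (ℤ.+ 0) :* p :* h := con (ℤ.+ 0)) refl (P x y) (hitWeight (y ∷ z ∷ zs)))

  χ-nonneg : ∀ y → 0# ≤ χ y
  χ-nonneg y with ¬? (y Fin.≟ b) ×-dec ¬? (y Fin.≟ k)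
  ... | yes (y≢b , y≢k) = subst (0# ≤_) (sym (χ-interior y≢b y≢k)) 0≤1
  ... | no  p           = ≤-reflexive (sym (χ-boundary p))

  hitWeight-nonneg : ∀ {t} (xs : Vec (Fin n) (suc t)) → 0# ≤ hitWeight xs
  hitWeight-nonneg (x ∷ [])         = ≤-refl
  hitWeight-nonneg (x ∷ y ∷ [])     = *-nonneg (P-nonneg (deg-positive b≢k x) y) (I-nonneg (b Fin.≟ y))
    where
    I-nonneg : Dec (b ≡ y) → 0# ≤ I b y
    I-nonneg (yes refl) = subst (0# ≤_) (sym (kronecker-refl b)) 0≤1
    I-nonneg (no  b≢y)  = ≤-reflexive (sym (kronecker-≢ b≢y))
  hitWeight-nonneg (x ∷ y ∷ z ∷ zs) =
    *-nonneg (*-nonneg (χ-nonneg y) (P-nonneg (deg-positive b≢k x) y)) (hitWeight-nonneg (y ∷ z ∷ zs))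

  sumVec-*ˡ : ∀ m c (f : Vec (Fin n) m → ℝ) → sumVec m (λ xs → c * f xs) ≡ c * sumVec m f
  sumVec-*ˡ zero    c f = refl
  sumVec-*ˡ (suc m) c f = trans (sum-cong-≗ λ x → sumVec-*ˡ m c (f ∘ (x ∷_))) (sym (*-sumˡ c (λ x → sumVec m (f ∘ (x ∷_)))))

  sumVec-sum : ∀ m {l} (f : Fin l → Vec (Fin n) m → ℝ) → sumVec m (λ xs → sum λ r → f r xs) ≡ sum λ r → sumVec m (f r)
  sumVec-sum zero        f = refl
  sumVec-sum (suc m) {l} f = trans (sum-cong-≗ λ x → sumVec-sum m (λ r xs → f r (x ∷ xs)))
    (∑-comm {n} {l} (λ x r → sumVec m (λ xs → f r (x ∷ xs))))

  sumVec-nonneg : ∀ m {f : Vec (Fin n) m → ℝ} → (∀ xs → 0# ≤ f xs) → 0# ≤ sumVec m f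
  sumVec-nonneg zero    p = p []
  sumVec-nonneg (suc m) p = sum-nonneg λ x → sumVec-nonneg m λ xs → p (x ∷ xs)

  sumVec≡0⇒term≡0 : ∀ m {f : Vec (Fin n) m → ℝ} → (∀ xs → 0# ≤ f xs) → sumVec m f ≡ 0# → ∀ xs → f xs ≡ 0#
  sumVec≡0⇒term≡0 zero    p eq []       = eq
  sumVec≡0⇒term≡0 (suc m) p eq (x ∷ xs) = sumVec≡0⇒term≡0 m (λ xs → p (x ∷ xs))
    (sum≡0⇒term≡0 (λ x → sumVec-nonneg m λ xs → p (x ∷ xs)) eq x) xs

  sumVec-zero : ∀ m {f : Vec (Fin n) m → ℝ} → (∀ xs → f xs ≡ 0#) → sumVec m f ≡ 0#
  sumVec-zero zero    p = p []
  sumVec-zero (suc m) p = sum-zero λ x → sumVec-zero m λ xs → p (x ∷ xs)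

  -- The paths have `t + 1` steps, and the starting vertex `x` is never tested against `b` or `k`.
  h : ℕ → Fin n → ℝ
  h t x = sumVec (suc t) λ ys → hitWeight (x ∷ ys)

  h-zero : ∀ x → h 0 x ≡ P x b
  h-zero x = trans (sum-cong-≗ λ y → *-comm (P x y) (I b y)) (sum-kronecker b (P x))

  h-suc : ∀ t x → h (suc t) x ≡ sum λ y → χ y * P x y * h t y
  h-suc t x = sum-cong-≗ λ y → sumVec-*ˡ (suc t) (χ y * P x y) (λ { (z ∷ zs) → hitWeight (y ∷ z ∷ zs) })

  module _ (c : Fin d) where
    H : ℕ → Fin n → Fin d → ℝ
    H t x r = sumVec (suc t) λ ys → hitWeight (x ∷ ys) * transport (x ∷ ys) r c

    H-zero : ∀ x r → H 0 x r ≡ P x b * σ x b r c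
    H-zero x r = begin
      sum (λ y → P x y * I b y * sum λ k → σ x y r k * I k c)
        ≡⟨ sum-cong-≗ (λ y → trans (cong (P x y * I b y *_) (trans
             (sum-cong-≗ λ k → trans (cong (σ x y r k *_) (kronecker-sym k c)) (*-comm _ _)) (sum-kronecker c (σ x y r))))
             (solve 3 (λ p i s → p :* i :* s := i :* (p :* s)) refl (P x y) (I b y) (σ x y r c))) ⟩
      sum (λ y → I b y * (P x y * σ x y r c))
        ≡⟨ sum-kronecker b (λ y → P x y * σ x y r c) ⟩
      P x b * σ x b r c ∎

    H-suc : ∀ t x r → H (suc t) x r ≡ sum λ y → χ y * P x y * sum λ k → σ x y r k * H t y k
    H-suc t x r = sum-cong-≗ λ y → begin
      sumVec (suc t) (λ zs → hitWeight (x ∷ y ∷ zs) * sum λ k → σ x y r k * transport (y ∷ zs) k c)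
        ≡⟨ sumVec-cong (suc t) {λ zs → hitWeight (x ∷ y ∷ zs) * sum λ k → σ x y r k * transport (y ∷ zs) k c} {λ zs → χ y * P x y * g y zs} (λ { (z ∷ zs) → trans (*-assoc _ _ _) (cong (χ y * P x y *_) (trans
             (*-sumˡ (hitWeight (y ∷ z ∷ zs)) (λ k → σ x y r k * transport (y ∷ z ∷ zs) k c))
             (sum-cong-≗ λ k → solve 3 (λ h s m → h :* (s :* m) := s :* (h :* m)) refl
               (hitWeight (y ∷ z ∷ zs)) (σ x y r k) (transport (y ∷ z ∷ zs) k c)))) }) ⟩
      sumVec (suc t) (λ zs → χ y * P x y * g y zs)
        ≡⟨ sumVec-*ˡ (suc t) (χ y * P x y) (g y) ⟩
      χ y * P x y * sumVec (suc t) (g y)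
        ≡⟨ cong (χ y * P x y *_) (trans
             (sumVec-sum (suc t) (λ k zs → σ x y r k * (hitWeight (y ∷ zs) * transport (y ∷ zs) k c)))
             (sum-cong-≗ λ k → sumVec-*ˡ (suc t) (σ x y r k) (λ zs → hitWeight (y ∷ zs) * transport (y ∷ zs) k c))) ⟩
      χ y * P x y * sum (λ k → σ x y r k * H t y k) ∎
      where
      g : Fin n → Vec (Fin n) (suc t) → ℝ
      g y zs = sum λ k → σ x y r k * (hitWeight (y ∷ zs) * transport (y ∷ zs) k c)

  Stopped : ∀ {t} → Vec (Fin n) (suc t) → Ω → Set
  Stopped xs ω = HittingPath b k xs × Along (λ t → X t ω) xs

  ℙ-Stopped : ∀ a {t} (xs : Vec (Fin n) (suc t)) → ℙ a (Stopped xs) ≡ I a (Vec.head xs) * hitWeight xs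
  ℙ-Stopped a xs with HittingPath? xs
  ... | yes p = trans (respects (λ ω → mk⇔ proj₂ (p ,_)) (event-const× (yes p) (event-path xs)))
                  (trans (ℙ-path a xs) (cong (I a (Vec.head xs) *_) (sym (hitWeight-hitting xs p))))
    where open IsProbabilityMeasure (isProbability a)
  ... | no ¬p = trans (ℙ-impossible a (event-const× (no ¬p) (event-path xs)) (λ ω q → ¬p (proj₁ q)))
                  (sym (trans (cong (I a (Vec.head xs) *_) (hitWeight-avoiding xs ¬p)) (zeroʳ _)))

  sumVec-start : ∀ a t (f : Vec (Fin n) (suc t) → ℝ) →
                 sumVec (suc t) (λ xs → I a (Vec.head xs) * f xs) ≡ sumVec t λ ys → f (a ∷ ys)
  sumVec-start a t f = trans (sum-cong-≗ λ x → sumVec-*ˡ t (I a x) (λ ys → f (x ∷ ys)))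
    (sum-kronecker a (λ x → sumVec t λ ys → f (x ∷ ys)))

  ℙ-Hits : ∀ a t → ℙ a (λ ω → Hits b k (λ s → X s ω) t) ≡ sumVec t λ ys → hitWeight (a ∷ ys)
  ℙ-Hits a t = begin
    ℙ a (λ ω → Hits b k (λ s → X s ω) t)
      ≡⟨ ℙ-paths a (suc t) (event-Hits b k t) X X-measurable ⟩
    sumVec (suc t) (λ xs → ℙ a (λ ω → Hits b k (λ s → X s ω) t × Along (λ s → X s ω) xs))
      ≡⟨ sumVec-cong (suc t) (λ xs → trans (respects (λ ω → mk⇔
           (λ p → Hits⇒HittingPath (λ s → X s ω) xs (proj₂ p) (proj₁ p) , proj₂ p)
           (λ p → HittingPath⇒Hits b≢k (λ s → X s ω) xs (proj₂ p) (proj₁ p) , proj₂ p))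
           (event-× (event-Hits b k t) (event-path xs))) (ℙ-Stopped a xs)) ⟩
    sumVec (suc t) (λ xs → I a (Vec.head xs) * hitWeight xs)
      ≡⟨ sumVec-start a t hitWeight ⟩
    sumVec t (λ ys → hitWeight (a ∷ ys)) ∎
    where open IsProbabilityMeasure (isProbability a)

  first-hit-unique : ∀ {s t ω} → (T¹[ b ]≐ s) ω → (T¹[ b ]≐ t) ω → s ≡ t
  first-hit-unique {s} {t} (1≤s , hit-s , before-s) (1≤t , hit-t , before-t) with ℕ.<-cmp s t
  ... | tri< s<t _ _ = contradiction hit-s (before-t s 1≤s s<t)
  ... | tri≈ _ s≡t _ = s≡t
  ... | tri> _ _ t<s = contradiction hit-t (before-s t 1≤t t<s)

  -- The summand at time 0 vanishes, which shifts the series by one.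
  HasSum-h : ∀ a → HasSum (λ t → h t a) (ℙ a T¹[ b ]<T¹[ k ])
  HasSum-h a = ⟶-cong shifted (⟶-suc (additive (event-Hits b k)
      (λ s t s≢t ω p → s≢t (first-hit-unique (proj₁ (proj₁ p)) (proj₁ (proj₂ p))))))
    where
    open IsProbabilityMeasure (isProbability a)
    shifted : ∀ N → partialSums (λ t → ℙ a (λ ω → Hits b k (λ s → X s ω) t)) (suc N) ≡ partialSums (λ t → h t a) N
    shifted N = trans (cong₂ _+_ (ℙ-Hits a 0) (partialSums-cong (λ t → ℙ-Hits a (suc t)) N)) (+-identityˡ _)

  module _ (a : Fin n) (r c : Fin d) where
    open IsProbabilityMeasure (isProbability a)

    private
      summand : ℕ → ℝ
      summand t = sumVec (suc t) λ xs →
        ℙ a (λ ω → T¹[ b ]<T¹[ k ] ω × (T¹[ b ]≐ t) ω × Follows xs ω) * transport xs r c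

    -- The event `T¹[ b ]<T¹[ k ]` comes with a hitting time of its own; uniqueness of the first hit
    -- identifies it with `t`.
    ℙ-stopped-trajectory : ∀ {t} (xs : Vec (Fin n) (suc t)) →
      ℙ a (λ ω → T¹[ b ]<T¹[ k ] ω × (T¹[ b ]≐ t) ω × Follows xs ω) ≡ I a (Vec.head xs) * hitWeight xs
    ℙ-stopped-trajectory {t} xs = trans
      (sym (respects (λ ω → mk⇔
        (λ p → let hits = HittingPath⇒Hits b≢k (λ s → X s ω) xs (proj₂ p) (proj₁ p)
               in (t , hits) , proj₁ hits , Equivalence.to (Along⇔Follows xs ω) (proj₂ p))
        (λ { ((s , hit-s , k∉) , hit-t , follows) →
               let along = Equivalence.from (Along⇔Follows xs ω) follows
               in Hits⇒HittingPath (λ s → X s ω) xs along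
                    (hit-t , subst (λ t → (T¹[ k ]> t) ω) (first-hit-unique hit-s hit-t) k∉) , along }))
        (event-const× (HittingPath? xs) (event-path xs))))
      (ℙ-Stopped a xs)

    summand-start : ∀ t → summand t ≡ sumVec t λ ys → hitWeight (a ∷ ys) * transport (a ∷ ys) r c
    summand-start t = trans
      (sumVec-cong (suc t) λ xs → trans (cong (_* transport xs r c) (ℙ-stopped-trajectory xs)) (*-assoc _ _ _))
      (sumVec-start a t (λ xs → hitWeight xs * transport xs r c))

    -- `∑∞` is a bare `lim`, so its value has to be read off from an established sum. The term at
    -- time 0 is zero, since `hitWeight` vanishes on a lone vertex.
    expectedTransport-sum : ∀ {e} → HasSum (λ t → H c t a r) e → expectedTransport a b k r c ≡ e
    expectedTransport-sum hasSum = ⟶⇒lim (⟶-pred (⟶-cong (λ N → sym (shifted N)) hasSum))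
      where
      shifted : ∀ N → partialSums summand (suc N) ≡ partialSums (λ t → H c t a r) N
      shifted N = trans (cong₂ _+_ (trans (summand-start 0) (zeroˡ _)) (partialSums-cong (λ t → summand-start (suc t)) N)) (+-identityˡ _)

    -- The path weights are nonnegative and add up to the probability, so each of them is 0, and
    -- with it each weighted transport.
    expectedTransport-null : ℙ a T¹[ b ]<T¹[ k ] ≡ 0# → expectedTransport a b k r c ≡ 0#
    expectedTransport-null ℙ≡0 = expectedTransport-sum (⟶-eventually-const 0 λ N _ → sum-zero {N} λ t →
      sumVec-zero (suc (toℕ t)) λ ys → trans (cong (_* transport (a ∷ ys) r c) (hitWeight≡0 (toℕ t) ys)) (zeroˡ _))
      where
      h≡0 : ∀ t → h t a ≡ 0#
      h≡0 = HasSum-0⇒≡0 (λ t → sumVec-nonneg (suc t) λ ys → hitWeight-nonneg (a ∷ ys))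
        (subst (HasSum (λ t → h t a)) ℙ≡0 (HasSum-h a))
      hitWeight≡0 : ∀ t (ys : Vec (Fin n) (suc t)) → hitWeight (a ∷ ys) ≡ 0#
      hitWeight≡0 t = sumVec≡0⇒term≡0 (suc t) (λ ys → hitWeight-nonneg (a ∷ ys)) (h≡0 t)

    -- Undoes the normalisation. On a null event `⁻¹` is applied to 0 and has no specified value,
    -- but both sides vanish.
    ℙ*Ω¹ : ℙ a T¹[ b ]<T¹[ k ] * Ω¹ a b k r c ≡ expectedTransport a b k r c
    ℙ*Ω¹ with ℙ a T¹[ b ]<T¹[ k ] ≟ℝ 0#
    ... | yes ℙ≡0 = trans (cong (_* Ω¹ a b k r c) ℙ≡0) (trans (zeroˡ _) (sym (expectedTransport-null ℙ≡0)))
    ... | no  ℙ≢0 = trans (sym (*-assoc _ _ _)) (trans (cong (_* expectedTransport a b k r c) (*-inverseʳ _ ℙ≢0)) (*-identityˡ _))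

-- Assembly of the conductance matrix.

module Conductance {𝓡 : RealNumbers} {n d : ℕ} {G : ConnectionGraph 𝓡 n d} (walk : SimpleRandomWalk G) (i j : Fin n) (i≢j : i ≢ j)
                   {L† : Matrices.Matrix 𝓡 n n}
                   (penrose : Matrices.IsMoorePenroseInverse 𝓡 (ConnectionGraph.L G) L†)
                   (D† : Matrices.Matrix 𝓡 (length (ConnectionGraph.others G i j) ℕ.* d) (length (ConnectionGraph.others G i j) ℕ.* d))
                   (penrose-D : Matrices.IsMoorePenroseInverse 𝓡 (ConnectionGraph.𝓛-others G i j) D†) where
  open RealNumbers 𝓡
  open Matrices 𝓡
  open FieldProperties orderedField
  open ConnectionGraph G
  open SimpleRandomWalk walk
  open KilledWalk G i j i≢j using (χ; χ-interior; χ-boundary)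
  open Stopping G i j i≢j penrose
  open SchurComplement G i j i≢j penrose D† penrose-D
  open ≡-Reasoning

  -- Both instances share the one `χ` of `KilledWalk`, so that their recursions involve the same
  -- `Q`; for the target `j` only the order of the two tests is exchanged.
  module Hit-i = HittingSums walk i j i≢j χ χ-interior χ-boundary
  module Hit-j = HittingSums walk j i (i≢j ∘ sym) χ (λ y≢j y≢i → χ-interior y≢i y≢j) (λ p → χ-boundary λ q → p (proj₂ q , proj₁ q))

  hits-i : HittingTimes i Hit-i.h
  hits-i = record { one-step = Hit-i.h-zero ; recursion = Hit-i.h-suc }

  hits-j : HittingTimes j Hit-j.h
  hits-j = record { one-step = Hit-j.h-zero ; recursion = Hit-j.h-suc }

  transports-i : ∀ c → Transports i c (Hit-i.H c)
  transports-i c = record { one-step = Hit-i.H-zero c ; recursion = Hit-i.H-suc c }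

  transports-j : ∀ c → Transports j c (Hit-j.H c)
  transports-j c = record { one-step = Hit-j.H-zero c ; recursion = Hit-j.H-suc c }

  C : Matrix (2 ℕ.* d) (2 ℕ.* d)
  C = conductanceMatrix i j D†

  -- The Schur complement unfolded at vertices instead of block positions, so that one formula
  -- serves all four blocks.
  C-entry : Fin n → Fin n → Matrix d d
  C-entry a b r c = block d 𝓛 a b r c
    - sum (λ p → sum (λ o → block d 𝓛 a (vertex o) r (index o) * D† o p) * block d 𝓛 (vertex p) b (index p) c)

  K : List (Fin n)
  K = i ∷ j ∷ []

  C-at : ∀ p q {s r t c} → remQuot {2} d p ≡ (s , r) → remQuot {2} d q ≡ (t , c) →
         C p q ≡ C-entry (List.lookup K s) (List.lookup K t) r c
  C-at p q = cong₂ λ sr tc → C-entry (List.lookup K (proj₁ sr)) (List.lookup K (proj₁ tc)) (proj₂ sr) (proj₂ tc)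

  C-entry-i : ∀ {a} → (∀ {x} → x ≢ i → x ≢ j → x ≢ a) → ∀ r c →
              C-entry a i r c ≡ deg a * (I a i * I r c) - deg a * (ℙ a T¹[ i ]<T¹[ j ] * Ω¹ a i j r c)
  C-entry-i {a} a∉ r c = trans (schur-entry a∉ (λ x≢i _ → x≢i) r)
    (cong (λ z → deg a * (I a i * I r c) - deg a * z)
      (sym (trans (Hit-i.ℙ*Ω¹ a r c) (Hit-i.expectedTransport-sum a r c (hasSum a r)))))
    where open Transports (transports-i c)

  C-entry-j : ∀ {a} → (∀ {x} → x ≢ i → x ≢ j → x ≢ a) → ∀ r c →
              C-entry a j r c ≡ deg a * (I a j * I r c) - deg a * (ℙ a T¹[ j ]<T¹[ i ] * Ω¹ a j i r c)
  C-entry-j {a} a∉ r c = trans (schur-entry a∉ (λ _ x≢j → x≢j) r)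
    (cong (λ z → deg a * (I a j * I r c) - deg a * z)
      (sym (trans (Hit-j.ℙ*Ω¹ a r c) (Hit-j.expectedTransport-sum a r c (hasSum a r)))))
    where open Transports (transports-j c)

  return+escape : ∀ a → ℙ a T¹[ i ]<T¹[ j ] + ℙ a T¹[ j ]<T¹[ i ] ≡ 1#
  return+escape a = hitting-total hits-i hits-j a (Hit-i.HasSum-h a) (Hit-j.HasSum-h a)

  c : ℝ
  c = effectiveConductance L† i j

  c≡i : c ≡ deg i * ℙ i T¹[ j ]<T¹[ i ]
  c≡i = effectiveConductance-i hits-i hits-j (Hit-i.HasSum-h i) (Hit-j.HasSum-h i)

  c≡j : c ≡ deg j * ℙ j T¹[ i ]<T¹[ j ]
  c≡j = effectiveConductance-j hits-i hits-j (Hit-i.HasSum-h j) (Hit-j.HasSum-h j)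

  -- `p` is the escape probability and `p′` the return probability that weights the transport.
  diagonal : ∀ {v p p′ ι ω δ} → δ ≡ 1# → p + p′ ≡ 1# → v * (δ * ι) - v * (p′ * ω) ≡ v * (ι - (1# - p) * ω)
  diagonal {v} {p} {p′} {ι} {ω} refl p+p′≡1 = begin
    v * (1# * ι) - v * (p′ * ω)
      ≡⟨ solve 5 (λ v i o p q → v :* (con (ℤ.+ 1) :* i) :- v :* (q :* o) := v :* (i :- ((p :+ q) :- p) :* o)) refl v ι ω p p′ ⟩
    v * (ι - ((p + p′) - p) * ω)
      ≡⟨ cong (λ z → v * (ι - (z - p) * ω)) p+p′≡1 ⟩
    v * (ι - (1# - p) * ω) ∎

  off-diagonal : ∀ {v p ι ω δ} → δ ≡ 0# → v * (δ * ι) - v * (p * ω) ≡ - (v * p) * ω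
  off-diagonal {v} {p} {ι} {ω} refl =
    solve 4 (λ v p i o → v :* (con (ℤ.+ 0) :* i) :- v :* (p :* o) := :- (v :* p) :* o) refl v p ι ω

  -- With `κ = v * p` the factor `v * (1# - p)` is `v - κ`; the second summand measures how far the
  -- mean transport is from the identity.
  split-diagonal : ∀ {v p ι ω κ} → κ ≡ v * p → v * (ι - (1# - p) * ω) ≡ κ * ι + (v - κ) * (ι - ω)
  split-diagonal {v} {p} {ι} {ω} refl =
    solve 4 (λ v p i o → v :* (i :- (con (ℤ.+ 1) :- p) :* o) := v :* p :* i :+ (v :- v :* p) :* (i :- o)) refl v p ι ω

  split-off-diagonal : ∀ {v p ι ω κ} → κ ≡ v * p → - (v * p) * ω ≡ κ * (- 1# * ι) + κ * (ι - ω)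
  split-off-diagonal {v} {p} {ι} {ω} refl =
    solve 4 (λ v p i o → :- (v :* p) :* o := v :* p :* (:- con (ℤ.+ 1) :* i) :+ v :* p :* (i :- o)) refl v p ι ω

  C-ii : ∀ r s → C-entry i i r s ≡ deg i * (I r s - (1# - ℙ i T¹[ j ]<T¹[ i ]) * Ω¹ i i j r s)
  C-ii r s = trans (C-entry-i (λ x≢i _ → x≢i) r s) (diagonal (kronecker-refl i) (trans (+-comm _ _) (return+escape i)))

  C-ij : ∀ r s → C-entry i j r s ≡ - (deg i * ℙ i T¹[ j ]<T¹[ i ]) * Ω¹ i j i r s
  C-ij r s = trans (C-entry-j (λ x≢i _ → x≢i) r s) (off-diagonal (kronecker-≢ i≢j))

  C-ji : ∀ r s → C-entry j i r s ≡ - (deg j * ℙ j T¹[ i ]<T¹[ j ]) * Ω¹ j i j r s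
  C-ji r s = trans (C-entry-i (λ _ x≢j → x≢j) r s) (off-diagonal (kronecker-≢ (i≢j ∘ sym)))

  C-jj : ∀ r s → C-entry j j r s ≡ deg j * (I r s - (1# - ℙ j T¹[ i ]<T¹[ j ]) * Ω¹ j j i r s)
  C-jj r s = trans (C-entry-j (λ _ x≢j → x≢j) r s) (diagonal (kronecker-refl j) (return+escape j))

  block-C : ∀ s t r u → block {2} {2} d C s t r u ≡ C-entry (List.lookup K s) (List.lookup K t) r u
  block-C s t r u = C-at (combine s r) (combine t u) (Fin.remQuot-combine {2} s r) (Fin.remQuot-combine {2} t u)

  -- `blocks₂` matches on the block indices and reduces only once `s` and `t` are known.
  blocks₂-at : ∀ (A : Fin 2 → Fin 2 → Matrix d d) p q {s r t u} → remQuot {2} d p ≡ (s , r) → remQuot {2} d q ≡ (t , u) →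
               blocks₂ d (A zero zero) (A zero (suc zero)) (A (suc zero) zero) (A (suc zero) (suc zero)) p q ≡ A s t r u
  blocks₂-at A p q {zero}     {t = zero}     eq eq′ rewrite cong proj₁ eq | cong proj₂ eq | cong proj₁ eq′ | cong proj₂ eq′ = refl
  blocks₂-at A p q {zero}     {t = suc zero} eq eq′ rewrite cong proj₁ eq | cong proj₂ eq | cong proj₁ eq′ | cong proj₂ eq′ = refl
  blocks₂-at A p q {suc zero} {t = zero}     eq eq′ rewrite cong proj₁ eq | cong proj₂ eq | cong proj₁ eq′ | cong proj₂ eq′ = refl
  blocks₂-at A p q {suc zero} {t = suc zero} eq eq′ rewrite cong proj₁ eq | cong proj₂ eq | cong proj₁ eq′ | cong proj₂ eq′ = refl

  Laplacian₂ Defect : Fin 2 → Fin 2 → Matrix d d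
  Laplacian₂ zero       zero       = I
  Laplacian₂ zero       (suc zero) = (- 1#) • I
  Laplacian₂ (suc zero) zero       = (- 1#) • I
  Laplacian₂ (suc zero) (suc zero) = I
  Defect     zero       zero       = (deg i - c) • (I ⊟ Ω¹ i i j)
  Defect     zero       (suc zero) = c • (I ⊟ Ω¹ i j i)
  Defect     (suc zero) zero       = c • (I ⊟ Ω¹ j i j)
  Defect     (suc zero) (suc zero) = (deg j - c) • (I ⊟ Ω¹ j j i)

  C-split : ∀ s t r u → C-entry (List.lookup K s) (List.lookup K t) r u ≡ c * Laplacian₂ s t r u + Defect s t r u
  C-split zero       zero       r u = trans (C-ii r u) (split-diagonal c≡i)
  C-split zero       (suc zero) r u = trans (C-ij r u) (split-off-diagonal c≡i)
  C-split (suc zero) zero       r u = trans (C-ji r u) (split-off-diagonal c≡j)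
  C-split (suc zero) (suc zero) r u = trans (C-jj r u) (split-diagonal c≡j)

  C-decomposition : C ≋ c • blocks₂ d I ((- 1#) • I) ((- 1#) • I) I
                      ⊞ blocks₂ d ((deg i - c) • (I ⊟ Ω¹ i i j)) (c • (I ⊟ Ω¹ i j i))
                                  (c • (I ⊟ Ω¹ j i j))           ((deg j - c) • (I ⊟ Ω¹ j j i))
  C-decomposition p q = trans (C-at p q refl refl) (trans (C-split (proj₁ (remQuot {2} d p)) (proj₁ (remQuot {2} d q)) _ _)
    (sym (cong₂ (λ x y → c * x + y) (blocks₂-at Laplacian₂ p q refl refl) (blocks₂-at Defect p q refl refl))))

theorem5p9 :
  (𝓡 : RealNumbers) →
  let open RealNumbers 𝓡
      open Matrices 𝓡
  in
  (n d : ℕ) (G : ConnectionGraph 𝓡 n d) (walk : SimpleRandomWalk G) →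
  let open ConnectionGraph G
      open SimpleRandomWalk walk
  in
  (i j : Fin n) → i ≢ j →
  ∀ D† → IsMoorePenroseInverse (𝓛-others i j) D† →
  ∀ L† → IsMoorePenroseInverse L L† →
  let C   = conductanceMatrix i j D†
      Cᵢᵢ = block {2} {2} d C zero zero
      Cⱼᵢ = block {2} {2} d C (suc zero) zero
      c   = effectiveConductance L† i j
  in
  (Cᵢᵢ ≋ deg i • (I ⊟ (1# - ℙ i T¹[ j ]<T¹[ i ]) • Ω¹ i i j))
  × (Cⱼᵢ ≋ (- (deg j * ℙ j T¹[ i ]<T¹[ j ])) • Ω¹ j i j)
  × (c ≡ deg i * ℙ i T¹[ j ]<T¹[ i ])
  × (c ≡ deg j * ℙ j T¹[ i ]<T¹[ j ])
  × (C ≋ c • blocks₂ d I ((- 1#) • I) ((- 1#) • I) I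
         ⊞ blocks₂ d ((deg i - c) • (I ⊟ Ω¹ i i j)) (c • (I ⊟ Ω¹ i j i))
                     (c • (I ⊟ Ω¹ j i j))           ((deg j - c) • (I ⊟ Ω¹ j j i)))
theorem5p9 𝓡 n d G walk i j i≢j D† penrose-D L† penrose =
    (λ r s → trans (block-C zero zero r s) (C-ii r s))
  , (λ r s → trans (block-C (suc zero) zero r s) (C-ji r s))
  , c≡i
  , c≡j
  , C-decomposition
  where open Conductance walk i j i≢j penrose D† penrose-D
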